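{- We have $$1+\sum_{n=1}^\infty\big(q^{n^2}+q^{5n^2}\big)=\frac{(q^2,q^8,q^{10};q^{10})_\infty\,(q^6,q^{14};q^{20})_\infty}{(q,q^4;q^5)_\infty}.$$
   Context: Here $q$ is a complex number with $|q|<1$ (equivalently, the identity may be read as an identity of formal power series in $q$). For a complex number $a$, $(a;q)_\infty:=\prod_{i=0}^\infty(1-aq^i)$, and $(a_1,a_2,\dots,a_m;q)_\infty:=\prod_{j=1}^m(a_j;q)_\infty$. -}

module Defs where

open import Data.Nat using (ℕ; zero; suc; _∸_; _≟_)
import Data.Nat as ℕ
open import Data.Integer using (ℤ; 0ℤ; 1ℤ; _+_; _*_; -_)
open import Data.List using (List; []; _∷_)
open import Relation.Nullary using (yes; no)
open import Relation.Binary.PropositionalEquality using (_≡_)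

-- Formal power series in q with integer coefficients: f n = coefficient of q^n.
FPS : Set
FPS = ℕ → ℤ

sumTo : ℕ → (ℕ → ℤ) → ℤ
sumTo zero    a = a 0
sumTo (suc n) a = sumTo n a + a (suc n)

_+ₛ_ : FPS → FPS → FPS
(f +ₛ g) n = f n + g n

_*ₛ_ : FPS → FPS → FPS
(f *ₛ g) n = sumTo n (λ i → f i * g (n ∸ i))

infixl 6 _+ₛ_
infixl 7 _*ₛ_

mono : ℕ → FPS
mono k n with n ≟ k
... | yes _ = 1ℤ
... | no  _ = 0ℤ

oneₛ : FPS
oneₛ = mono 0

oneMinus : ℕ → FPS
oneMinus k n = oneₛ n + - mono k n

prodTo : ℕ → (ℕ → FPS) → FPS
prodTo zero    F = F 0
prodTo (suc n) F = prodTo n F *ₛ F (suc n)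

-- (q^a ; q^m)_∞ = ∏_{i≥0} (1 - q^{a + m i}), as a formal power series (a ≥ 1, m ≥ 1).
-- Coefficient of q^N: since a + m i > N for i > N, the factors with i > N are
-- ≡ 1 mod q^{N+1}, so the coefficient equals that of the finite product over i ≤ N.
poch : ℕ → ℕ → FPS
poch a m N = prodTo N (λ i → oneMinus (a ℕ.+ m ℕ.* i)) N

-- Multiplicative inverse of a power series f with f 0 = 1:
-- c 0 = 1, c (n+1) = - Σ_{j=1}^{n+1} f j * c (n+1-j).
-- revInv f n = [c n, c (n-1), ..., c 0].
dot : FPS → ℕ → List ℤ → ℤ
dot f k []       = 0ℤ
dot f k (x ∷ xs) = f k * x + dot f (suc k) xs

revInv : FPS → ℕ → List ℤ
revInv f zero    = 1ℤ ∷ []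
revInv f (suc n) = (- dot f 1 (revInv f n)) ∷ revInv f n

headOr0 : List ℤ → ℤ
headOr0 []      = 0ℤ
headOr0 (x ∷ _) = x

invₛ : FPS → FPS
invₛ f n = headOr0 (revInv f n)

-- Left side: 1 + Σ_{n≥1} (q^{n²} + q^{5n²}).  Coefficient of q^N: terms with
-- n > N have exponent > N, so the partial sum over 1 ≤ n ≤ N+1 suffices.
lhsSeries : FPS
lhsSeries N = (oneₛ +ₛ sumS) N
  where
  sumS : FPS
  sumS M = sumTo M (λ n → mono (suc n ℕ.* suc n) M + mono (5 ℕ.* (suc n ℕ.* suc n)) M)

numerator : FPS
numerator = poch 2 10 *ₛ poch 8 10 *ₛ poch 10 10 *ₛ poch 6 20 *ₛ poch 14 20

denominator : FPS
denominator = poch 1 5 *ₛ poch 4 5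

{-# OPTIONS --safe #-}
module Submission where

-- Write f(a, b) = ∑_n a^(n(n+1)/2) b^(n(n-1)/2) and φ(q) = f(q, q), so that twice the left side is
-- φ(q) + φ(q⁵).  Put f₁ = f(-q, -q⁴), f₂ = f(-q², -q³), x₀ = φ(q⁵), x₁ = f(q⁷, q³), x₂ = f(q⁹, q).
-- Rearranging double sums over ℤ² along sublattices of index 2 expands f₁², f₂² and f₁f₂ in theta
-- series of base q¹⁰, and eliminating the common factor f(q¹⁰, 1) gives x₀f₁f₂ = x₁f₂² - q x₂f₁².
-- Multiplication by a Gaussian integer of norm 5 gives φ(q)² = x₀² + 4 q x₁x₂.  Hence
-- (φ(q) f₁f₂)² = (x₁f₂² + q x₂f₁²)²; comparing constant terms to choose the square root yields
-- (φ(q) + x₀) f₁ = 2 x₁f₂, and the Jacobi triple product turns f₁, f₂, x₁ into the products of the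
-- right side.

open import Defs
open import Level using (0ℓ)
open import Algebra using (CommutativeRing)
import Algebra.Solver.Ring
open import Algebra.Solver.Ring.AlmostCommutativeRing using (fromCommutativeRing; _-Raw-AlmostCommutative⟶_)
open import Data.Empty using (⊥-elim)
open import Data.Fin using (Fin; zero; suc; toℕ; fromℕ<)
open import Data.Fin.Properties using (toℕ-fromℕ<; toℕ<n; toℕ-injective)
open import Data.Integer using (ℤ; +_; -[1+_]; 0ℤ; 1ℤ; -1ℤ; _+_; _*_; -_; _-_; ∣_∣; _⊖_; _/ℕ_)
import Data.Integer as ℤ
import Data.Integer.Properties as ℤₚ
open import Data.Integer.DivMod using (n%ℕd<d; a≡a%ℕn+[a/ℕn]*n)
open import Data.Integer.Tactic.RingSolver using (solve-∀)
open import Data.List using (List; []; _∷_; _++_; map; filter; cartesianProduct; downFrom)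
open import Data.List.Membership.Propositional using (_∈_)
open import Data.List.Membership.Propositional.Properties using (∈-map⁺; ∈-map⁻; ∈-++⁺ˡ; ∈-++⁺ʳ; ∈-filter⁺; ∈-filter⁻; ∈-cartesianProduct⁺; ∈-downFrom⁺)
open import Data.List.Membership.Propositional.Properties.WithK using (unique∧set⇒bag)
open import Data.List.Relation.Binary.BagAndSetEquality using (∼bag⇒↭)
open import Data.List.Relation.Binary.Permutation.Propositional as ↭ using (_↭_)
open import Data.List.Relation.Unary.Unique.Propositional using (Unique; [])
import Data.List.Relation.Unary.Unique.Propositional.Properties as Unique
open import Data.Maybe as Maybe using (Maybe)
open import Data.Nat using (ℕ; zero; suc; _∸_; _≤_; _<_; z≤n; s≤s; _⊔_)
import Data.Nat as ℕ
import Data.Nat.Properties as ℕₚ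
open import Data.Nat.Solver using (module +-*-Solver)
open import Data.Product using (_,_; _×_; proj₁; proj₂; ∃)
open import Data.Sum using (_⊎_; inj₁; inj₂; [_,_])
open import Data.Sum.Properties using (inj₁-injective; inj₂-injective)
open import Function using (_∘_; mk⇔)
open import Relation.Binary.PropositionalEquality as ≡ using (_≡_; _≢_; cong; cong₂; subst)
open import Relation.Nullary using (yes; no; ¬_; ¬?)
open import Relation.Nullary.Decidable using (dec⇒maybe)

-- The ring of power series

-- Reordering a double theta sum needs a formal substitute for absolute convergence. A series is
-- therefore presented as a family of weighted monomials in which each exponent occurs finitely
-- often, and a bijection of index sets that respects weights and exponents preserves the sum. Twice
-- an exponent is an integer quadratic polynomial in the indices, so each rearrangement comes down
-- to a ring identity. Inverses of series appear only in the final theorem. Elsewhere a common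
-- factor is cancelled by its nonzero constant term, which suffices over ℤ even when that term is 2
-- and the factor is not a unit. In the triple product the variable z stays specialised to ±q^a,
-- with positive exponents `a` and `b`, so that the two-sided series remains an ordinary power
-- series and no Laurent variable is introduced.

infix 4 _≈_
-- A record rather than the bare pointwise statement, so that `f` and `g` can be recovered from the
-- type by unification.
record _≈_ (f g : FPS) : Set where
  constructor mk≈
  field at : ∀ n → f n ≡ g n
open _≈_ public

tail : FPS → FPS
tail f n = f (suc n)

infixr 7 _·_
_·_ : ℤ → FPS → FPS
(c · f) n = c * f n

zeroₛ : FPS
zeroₛ _ = 0ℤ

negₛ : FPS → FPS
negₛ f n = - f n

sumTo-cong : ∀ n {a b : ℕ → ℤ} → (∀ i → i ≤ n → a i ≡ b i) → sumTo n a ≡ sumTo n b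
sumTo-cong zero    h = h 0 z≤n
sumTo-cong (suc n) h = cong₂ _+_ (sumTo-cong n λ i i≤n → h i (ℕₚ.m≤n⇒m≤1+n i≤n)) (h (suc n) ℕₚ.≤-refl)

sumTo-first : ∀ n a → sumTo (suc n) a ≡ a 0 + sumTo n (a ∘ suc)
sumTo-first zero    a = ≡.refl
sumTo-first (suc n) a = ≡.trans (cong (_+ a (suc (suc n))) (sumTo-first n a))
                                (ℤₚ.+-assoc (a 0) (sumTo n (a ∘ suc)) (a (suc (suc n))))

-- Splitting off the constant term of the left factor makes the convolution recursive in the
-- coefficient index. The ring laws are inductions along this recursion, which avoids reindexing
-- nested sums.
*ₛ-first : ∀ f g n → (f *ₛ g) (suc n) ≡ f 0 * g (suc n) + (tail f *ₛ g) n
*ₛ-first f g n = sumTo-first n (λ i → f i * g (suc n ∸ i))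

*ₛ-last : ∀ f g n → (f *ₛ g) (suc n) ≡ (f *ₛ tail g) n + f (suc n) * g 0
*ₛ-last f g n = cong₂ _+_
  (sumTo-cong n λ i i≤n → cong (λ k → f i * g k) (ℕₚ.+-∸-assoc 1 i≤n))
  (cong (λ k → f (suc n) * g k) (ℕₚ.n∸n≡0 n))

infix 4 _≈[_]_
_≈[_]_ : FPS → ℕ → FPS → Set
f ≈[ N ] g = ∀ n → n ≤ N → f n ≡ g n

+ₛ-cong[] : ∀ {N f f′ g g′} → f ≈[ N ] f′ → g ≈[ N ] g′ → f +ₛ g ≈[ N ] f′ +ₛ g′
+ₛ-cong[] p r n n≤N = cong₂ _+_ (p n n≤N) (r n n≤N)

*ₛ-cong[] : ∀ {N f f′ g g′} → f ≈[ N ] f′ → g ≈[ N ] g′ → f *ₛ g ≈[ N ] f′ *ₛ g′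
*ₛ-cong[] p r n n≤N = sumTo-cong n λ i i≤n →
  cong₂ _*_ (p i (ℕₚ.≤-trans i≤n n≤N)) (r (n ∸ i) (ℕₚ.≤-trans (ℕₚ.m∸n≤m n i) n≤N))

≈[]-refl : ∀ {N f} → f ≈[ N ] f
≈[]-refl n _ = ≡.refl

≈[]-sym : ∀ {N f g} → f ≈[ N ] g → g ≈[ N ] f
≈[]-sym p n n≤N = ≡.sym (p n n≤N)

≈[]-trans : ∀ {N f g h} → f ≈[ N ] g → g ≈[ N ] h → f ≈[ N ] h
≈[]-trans p r n n≤N = ≡.trans (p n n≤N) (r n n≤N)

≈[]-mono : ∀ {M N f g} → M ≤ N → f ≈[ N ] g → f ≈[ M ] g
≈[]-mono M≤N p n n≤M = p n (ℕₚ.≤-trans n≤M M≤N)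

≈⇒≈[] : ∀ {N f g} → f ≈ g → f ≈[ N ] g
≈⇒≈[] p n _ = at p n

≈[]⇒≈ : ∀ {f g} → (∀ N → f ≈[ N ] g) → f ≈ g
≈[]⇒≈ p = mk≈ λ n → p n n ℕₚ.≤-refl

*ₛ-cong : ∀ {f f′ g g′} → f ≈ f′ → g ≈ g′ → f *ₛ g ≈ f′ *ₛ g′
*ₛ-cong p r = ≈[]⇒≈ λ N → *ₛ-cong[] {N} (≈⇒≈[] p) (≈⇒≈[] r)

*ₛ-comm : ∀ f g → f *ₛ g ≈ g *ₛ f
*ₛ-comm f g = mk≈ λ n → go n f g
  where
  go : ∀ n f g → (f *ₛ g) n ≡ (g *ₛ f) n
  go zero    f g = ℤₚ.*-comm (f 0) (g 0)
  go (suc n) f g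
    rewrite *ₛ-first f g n | *ₛ-last g f n | go n (tail f) g | ℤₚ.*-comm (f 0) (g (suc n)) =
      ℤₚ.+-comm (g (suc n) * f 0) ((g *ₛ tail f) n)

*ₛ-distribʳ : ∀ f g h → (g +ₛ h) *ₛ f ≈ g *ₛ f +ₛ h *ₛ f
*ₛ-distribʳ f g h = mk≈ λ n → go n g h
  where
  lemma : ∀ a b c d e → (a + b) * c + (d + e) ≡ (a * c + d) + (b * c + e)
  lemma = solve-∀
  go : ∀ n g h → ((g +ₛ h) *ₛ f) n ≡ (g *ₛ f) n + (h *ₛ f) n
  go zero    g h = ℤₚ.*-distribʳ-+ (f 0) (g 0) (h 0)
  go (suc n) g h rewrite *ₛ-first (g +ₛ h) f n | *ₛ-first g f n | *ₛ-first h f n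
    | go n (tail g) (tail h) =
      lemma (g 0) (h 0) (f (suc n)) ((tail g *ₛ f) n) ((tail h *ₛ f) n)

·-*ₛ : ∀ c f g → (c · f) *ₛ g ≈ c · (f *ₛ g)
·-*ₛ c f g = mk≈ λ n → go n f
  where
  go : ∀ n f → ((c · f) *ₛ g) n ≡ c * (f *ₛ g) n
  go zero    f = ℤₚ.*-assoc c (f 0) (g 0)
  go (suc n) f rewrite *ₛ-first (c · f) g n | *ₛ-first f g n | go n (tail f)
    | ℤₚ.*-assoc c (f 0) (g (suc n)) =
      ≡.sym (ℤₚ.*-distribˡ-+ c (f 0 * g (suc n)) ((tail f *ₛ g) n))

*ₛ-assoc : ∀ f g h → (f *ₛ g) *ₛ h ≈ f *ₛ (g *ₛ h)
*ₛ-assoc f g h = mk≈ λ n → go n f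
  where
  lemma : ∀ a b c d e → a * b * c + (a * d + e) ≡ a * (b * c + d) + e
  lemma = solve-∀
  go : ∀ n f → ((f *ₛ g) *ₛ h) n ≡ (f *ₛ (g *ₛ h)) n
  go zero    f = ℤₚ.*-assoc (f 0) (g 0) (h 0)
  go (suc n) f
    rewrite *ₛ-first (f *ₛ g) h n | *ₛ-first f (g *ₛ h) n | *ₛ-first g h n
    -- The tail of `f *ₛ g` is `f 0 · tail g +ₛ tail f *ₛ g`, and the next two rewrites distribute
    -- `h` over it.
    | at (*ₛ-cong {g = h} (mk≈ (*ₛ-first f g)) (mk≈ λ _ → ≡.refl)) n
    | at (*ₛ-distribʳ h (f 0 · tail g) (tail f *ₛ g)) n
    | at (·-*ₛ (f 0) (tail g) h) n
    | go n (tail f) =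
      lemma (f 0) (g 0) (h (suc n)) ((tail g *ₛ h) n) ((tail f *ₛ (g *ₛ h)) n)

zeroₛ-*ₛ : ∀ f → zeroₛ *ₛ f ≈ zeroₛ
zeroₛ-*ₛ f = mk≈ go
  where
  go : ∀ n → (zeroₛ *ₛ f) n ≡ 0ℤ
  go zero    = ≡.refl
  go (suc n) rewrite *ₛ-first zeroₛ f n | go n = ≡.refl

*ₛ-identityˡ : ∀ f → oneₛ *ₛ f ≈ f
*ₛ-identityˡ f = mk≈ go
  where
  go : ∀ n → (oneₛ *ₛ f) n ≡ f n
  go zero    = ℤₚ.*-identityˡ (f 0)
  go (suc n) rewrite *ₛ-first oneₛ f n | at (zeroₛ-*ₛ f) n | ℤₚ.*-identityˡ (f (suc n)) =
    ℤₚ.+-identityʳ (f (suc n))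

FPS-ring : CommutativeRing 0ℓ 0ℓ
FPS-ring = record
  { Carrier = FPS ; _≈_ = _≈_ ; _+_ = _+ₛ_ ; _*_ = _*ₛ_ ; -_ = negₛ ; 0# = zeroₛ ; 1# = oneₛ
  ; isCommutativeRing = record
    { isRing = record
      { +-isAbelianGroup = record
        { isGroup = record
          { isMonoid = record
            { isSemigroup = record
              { isMagma = record
                { isEquivalence = record
                  { refl  = mk≈ λ _ → ≡.refl
                  ; sym   = λ p → mk≈ λ n → ≡.sym (at p n)
                  ; trans = λ p r → mk≈ λ n → ≡.trans (at p n) (at r n) }
                ; ∙-cong = λ p r → mk≈ λ n → cong₂ _+_ (at p n) (at r n) }
              ; assoc = λ f g h → mk≈ λ n → ℤₚ.+-assoc (f n) (g n) (h n) }
            ; identity = (λ f → mk≈ λ n → ℤₚ.+-identityˡ (f n))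
                       , (λ f → mk≈ λ n → ℤₚ.+-identityʳ (f n)) }
          ; inverse = (λ f → mk≈ λ n → ℤₚ.+-inverseˡ (f n))
                    , (λ f → mk≈ λ n → ℤₚ.+-inverseʳ (f n))
          ; ⁻¹-cong = λ p → mk≈ λ n → cong -_ (at p n) }
        ; comm = λ f g → mk≈ λ n → ℤₚ.+-comm (f n) (g n) }
      ; *-cong = *ₛ-cong
      ; *-assoc = *ₛ-assoc
      ; *-identity = *ₛ-identityˡ
                   , (λ f → mk≈ λ n → ≡.trans (at (*ₛ-comm f oneₛ) n) (at (*ₛ-identityˡ f) n))
      ; distrib = (λ f g h → mk≈ λ n → ≡.trans (at (*ₛ-comm f (g +ₛ h)) n)
                     (≡.trans (at (*ₛ-distribʳ f g h) n)
                              (cong₂ _+_ (at (*ₛ-comm g f) n) (at (*ₛ-comm h f) n))))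
                , *ₛ-distribʳ }
    ; *-comm = *ₛ-comm } }

open CommutativeRing FPS-ring public
  using (setoid)
  renaming ( refl to ≈-refl; sym to ≈-sym; trans to ≈-trans; +-cong to +ₛ-cong; +-comm to +ₛ-comm
           ; -‿cong to negₛ-cong; *-identityʳ to *ₛ-identityʳ; zeroʳ to *ₛ-zeroʳ)

·-cong : ∀ {c d f g} → c ≡ d → f ≈ g → c · f ≈ d · g
·-cong p r = mk≈ λ n → cong₂ _*_ p (at r n)

·-*ₛ-· : ∀ c d f g → (c · f) *ₛ (d · g) ≈ (c * d) · (f *ₛ g)
·-*ₛ-· c d f g = mk≈ λ n →
  ≡.trans (at (·-*ₛ c f (d · g)) n) (≡.trans (cong (c *_)
    (≡.trans (at (*ₛ-comm f (d · g)) n) (≡.trans (at (·-*ₛ d g f) n) (cong (d *_) (at (*ₛ-comm g f) n)))))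
    (≡.sym (ℤₚ.*-assoc c d _)))

private
  constants : ℤ.+-*-rawRing -Raw-AlmostCommutative⟶ fromCommutativeRing FPS-ring
  constants = record
    { ⟦_⟧    = _· oneₛ
    ; +-homo = λ c d → mk≈ λ n → ℤₚ.*-distribʳ-+ (oneₛ n) c d
    ; *-homo = λ c d → ≈-sym (≈-trans (·-*ₛ-· c d oneₛ oneₛ) (·-cong {c * d} ≡.refl (*ₛ-identityˡ oneₛ)))
    ; -‿homo = λ c → mk≈ λ n → ≡.sym (ℤₚ.neg-distribˡ-* c (oneₛ n))
    ; 0-homo = mk≈ λ n → ≡.refl
    ; 1-homo = mk≈ λ n → ℤₚ.*-identityˡ (oneₛ n) }

  constants-≟ : ∀ c d → Maybe (c · oneₛ ≈ d · oneₛ)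
  constants-≟ c d = Maybe.map (λ c≡d → ·-cong c≡d ≈-refl) (dec⇒maybe (c ℤ.≟ d))

module Solver = Algebra.Solver.Ring ℤ.+-*-rawRing (fromCommutativeRing FPS-ring) constants constants-≟

*ₛ-congˡ : ∀ f {g h} → g ≈ h → f *ₛ g ≈ f *ₛ h
*ₛ-congˡ f p = *ₛ-cong {f} ≈-refl p

*ₛ-congʳ : ∀ f {g h} → g ≈ h → g *ₛ f ≈ h *ₛ f
*ₛ-congʳ f p = *ₛ-cong {g = f} p ≈-refl

+ₛ-congˡ : ∀ f {g h} → g ≈ h → f +ₛ g ≈ f +ₛ h
+ₛ-congˡ f p = +ₛ-cong {f} ≈-refl p

+ₛ-congʳ : ∀ f {g h} → g ≈ h → g +ₛ f ≈ h +ₛ f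
+ₛ-congʳ f p = +ₛ-cong {u = f} p ≈-refl

≡⇒≈ : ∀ {f g} → f ≡ g → f ≈ g
≡⇒≈ ≡.refl = ≈-refl

-- Monomials, cancellation and inverses

mono-refl : ∀ k → mono k k ≡ 1ℤ
mono-refl k with k ℕ.≟ k
... | yes _   = ≡.refl
... | no  k≢k = ⊥-elim (k≢k ≡.refl)

mono-≢ : ∀ {k n} → n ≢ k → mono k n ≡ 0ℤ
mono-≢ {k} {n} n≢k with n ℕ.≟ k
... | yes n≡k = ⊥-elim (n≢k n≡k)
... | no  _   = ≡.refl

mono-suc : ∀ k n → mono (suc k) (suc n) ≡ mono k n
mono-suc k n with n ℕ.≟ k
... | yes ≡.refl = mono-refl (suc k)
... | no  n≢k    = mono-≢ {suc k} {suc n} (n≢k ∘ ℕₚ.suc-injective)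

mono-≈[]-0 : ∀ {k N} → N < k → mono k ≈[ N ] zeroₛ
mono-≈[]-0 N<k n n≤N = mono-≢ (ℕₚ.<⇒≢ (ℕₚ.≤-<-trans n≤N N<k))

mono-suc-*ₛ : ∀ k f n → (mono (suc k) *ₛ f) (suc n) ≡ (mono k *ₛ f) n
mono-suc-*ₛ k f n = ≡.trans (*ₛ-first (mono (suc k)) f n)
  (≡.trans (ℤₚ.+-identityˡ _) (at (*ₛ-congʳ f (mk≈ (mono-suc k))) n))

mono-*ₛ-mono : ∀ k l → mono k *ₛ mono l ≈ mono (k ℕ.+ l)
mono-*ₛ-mono zero    l = *ₛ-identityˡ (mono l)
mono-*ₛ-mono (suc k) l = mk≈ go
  where
  go : ∀ n → (mono (suc k) *ₛ mono l) n ≡ mono (suc k ℕ.+ l) n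
  go zero    = ≡.refl
  go (suc n) = ≡.trans (mono-suc-*ₛ k (mono l) n)
                       (≡.trans (at (mono-*ₛ-mono k l) n) (≡.sym (mono-suc (k ℕ.+ l) n)))

-- Multiplication by q^k raises the order of agreement by `k`. This gain is what `P-*ₛ-shifted`
-- lives on.
mono-*ₛ-cong[] : ∀ k {N f g} → f ≈[ N ] g → mono k *ₛ f ≈[ k ℕ.+ N ] mono k *ₛ g
mono-*ₛ-cong[] zero    {N} p = *ₛ-cong[] {N} {oneₛ} ≈[]-refl p
mono-*ₛ-cong[] (suc k) p zero    _         = ≡.refl
mono-*ₛ-cong[] (suc k) {N} {f} {g} p (suc n) (s≤s n≤) =
  ≡.trans (mono-suc-*ₛ k f n) (≡.trans (mono-*ₛ-cong[] k p n n≤) (≡.sym (mono-suc-*ₛ k g n)))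

-- If `h` vanishes up to order N, the next coefficient of the product is `f 0 * h (suc N)`, and ℤ
-- has no zero divisors. A nonzero constant term is enough; it need not be a unit.
*ₛ-zero-cancel : ∀ f h → f 0 ≢ 0ℤ → f *ₛ h ≈ zeroₛ → h ≈ zeroₛ
*ₛ-zero-cancel f h f₀≢0 fh≈0 = ≈[]⇒≈ go
  where
  root : ∀ n → f 0 * h n ≡ 0ℤ → h n ≡ 0ℤ
  root n eq with ℤₚ.i*j≡0⇒i≡0∨j≡0 (f 0) eq
  ... | inj₁ f₀≡0 = ⊥-elim (f₀≢0 f₀≡0)
  ... | inj₂ hₙ≡0 = hₙ≡0
  go : ∀ N → h ≈[ N ] zeroₛ
  go zero    zero z≤n = root 0 (at fh≈0 0)
  go (suc N) n n≤1+N with ℕₚ.m≤n⇒m<n∨m≡n n≤1+N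
  ... | inj₁ (s≤s n≤N) = go N n n≤N
  ... | inj₂ ≡.refl    = root (suc N) (begin
    f 0 * h (suc N)                    ≡⟨ ℤₚ.+-identityʳ _ ⟨
    f 0 * h (suc N) + 0ℤ               ≡⟨ cong (_+_ (f 0 * h (suc N))) lower ⟨
    f 0 * h (suc N) + (tail f *ₛ h) N  ≡⟨ *ₛ-first f h N ⟨
    (f *ₛ h) (suc N)                   ≡⟨ at fh≈0 (suc N) ⟩
    0ℤ                                 ∎)
    where
    open ≡.≡-Reasoning
    lower : (tail f *ₛ h) N ≡ 0ℤ
    lower = ≡.trans (*ₛ-cong[] {N} {tail f} ≈[]-refl (go N) N ℕₚ.≤-refl)
              (at (*ₛ-zeroʳ (tail f)) N)

negₛ-zero⇒≈ : ∀ {f g} → f +ₛ negₛ g ≈ zeroₛ → f ≈ g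
negₛ-zero⇒≈ p = mk≈ λ n → ℤₚ.i-j≡0⇒i≡j _ _ (at p n)

≈⇒negₛ-zero : ∀ {f g} → f ≈ g → f +ₛ negₛ g ≈ zeroₛ
≈⇒negₛ-zero p = mk≈ λ n → ℤₚ.i≡j⇒i-j≡0 (at p n)

*ₛ-cancelˡ : ∀ f {g h} → f 0 ≢ 0ℤ → f *ₛ g ≈ f *ₛ h → g ≈ h
*ₛ-cancelˡ f {g} {h} f₀≢0 p = negₛ-zero⇒≈ (*ₛ-zero-cancel f (g +ₛ negₛ h) f₀≢0
  (≈-trans (solve 3 (λ f g h → f :* (g :+ :- h) := f :* g :+ :- (f :* h)) ≈-refl f g h)
           (≈⇒negₛ-zero p)))
  where open Solver

-- The list `revInv f n` runs through the coefficients of the inverse downwards, so `dot` is a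
-- convolution with a shift of `f`. Only `k = 1` is wanted, but the recursion of `dot` raises `k`.
dot-revInv : ∀ f k n → dot f k (revInv f n) ≡ ((λ i → f (k ℕ.+ i)) *ₛ invₛ f) n
dot-revInv f k zero    = ≡.trans (ℤₚ.+-identityʳ _) (cong (λ i → f i * 1ℤ) (≡.sym (ℕₚ.+-identityʳ k)))
dot-revInv f k (suc n) = begin
  f k * invₛ f (suc n) + dot f (suc k) (revInv f n)
    ≡⟨ cong₂ (λ i r → f i * invₛ f (suc n) + r) (≡.sym (ℕₚ.+-identityʳ k)) (dot-revInv f (suc k) n) ⟩
  f (k ℕ.+ 0) * invₛ f (suc n) + ((λ i → f (suc k ℕ.+ i)) *ₛ invₛ f) n
    ≡⟨ cong (_+_ (f (k ℕ.+ 0) * invₛ f (suc n)))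
         (at (*ₛ-congʳ (invₛ f) (mk≈ λ i → cong f (≡.sym (ℕₚ.+-suc k i)))) n) ⟩
  f (k ℕ.+ 0) * invₛ f (suc n) + (tail (λ i → f (k ℕ.+ i)) *ₛ invₛ f) n
    ≡⟨ *ₛ-first (λ i → f (k ℕ.+ i)) (invₛ f) n ⟨
  ((λ i → f (k ℕ.+ i)) *ₛ invₛ f) (suc n) ∎
  where open ≡.≡-Reasoning

*ₛ-inverseʳ : ∀ f → f 0 ≡ 1ℤ → f *ₛ invₛ f ≈ oneₛ
*ₛ-inverseʳ f f₀≡1 = mk≈ go
  where
  go : ∀ n → (f *ₛ invₛ f) n ≡ oneₛ n
  go zero    = ≡.trans (ℤₚ.*-identityʳ (f 0)) f₀≡1
  go (suc n) rewrite *ₛ-first f (invₛ f) n | dot-revInv f 1 n | f₀≡1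
    | ℤₚ.*-identityˡ (- (tail f *ₛ invₛ f) n) = ℤₚ.+-inverseˡ ((tail f *ₛ invₛ f) n)

-- Limits of power series

Lim : (ℕ → FPS) → FPS → Set
Lim s S = ∀ N → ∃ λ K → ∀ n → K ≤ n → s n ≈[ N ] S

Lim-unique : ∀ {s S S′} → Lim s S → Lim s S′ → S ≈ S′
Lim-unique l l′ = ≈[]⇒≈ λ N → let (K , p) = l N ; (K′ , p′) = l′ N in
  ≈[]-trans (≈[]-sym (p (K ⊔ K′) (ℕₚ.m≤m⊔n K K′))) (p′ (K ⊔ K′) (ℕₚ.m≤n⊔m K K′))

Lim-const : ∀ f → Lim (λ _ → f) f
Lim-const f N = 0 , λ _ _ → ≈[]-refl

Lim-cong : ∀ {s s′ S S′} → (∀ n → s n ≈ s′ n) → S ≈ S′ → Lim s S → Lim s′ S′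
Lim-cong p r l N = let (K , h) = l N in
  K , λ n K≤n → ≈[]-trans (≈[]-sym (≈⇒≈[] (p n))) (≈[]-trans (h n K≤n) (≈⇒≈[] r))

Lim-*ₛ : ∀ {s s′ S S′} → Lim s S → Lim s′ S′ → Lim (λ n → s n *ₛ s′ n) (S *ₛ S′)
Lim-*ₛ l l′ N = let (K , p) = l N ; (K′ , p′) = l′ N in
  K ⊔ K′ , λ n h → *ₛ-cong[] (p n (ℕₚ.m⊔n≤o⇒m≤o K K′ h)) (p′ n (ℕₚ.m⊔n≤o⇒n≤o K K′ h))

Lim-+ₛ : ∀ {s s′ S S′} → Lim s S → Lim s′ S′ → Lim (λ n → s n +ₛ s′ n) (S +ₛ S′)
Lim-+ₛ l l′ N = let (K , p) = l N ; (K′ , p′) = l′ N in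
  K ⊔ K′ , λ n h → +ₛ-cong[] (p n (ℕₚ.m⊔n≤o⇒m≤o K K′ h)) (p′ n (ℕₚ.m⊔n≤o⇒n≤o K K′ h))

Lim-subseq : ∀ {s S} (k : ℕ → ℕ) → (∀ n → n ≤ k n) → Lim s S → Lim (s ∘ k) S
Lim-subseq k n≤kn l N = let (K , p) = l N in K , λ n K≤n → p (k n) (ℕₚ.≤-trans K≤n (n≤kn n))

Lim-unshift : ∀ {s S} → Lim (s ∘ suc) S → Lim s S
Lim-unshift l N = let (K , p) = l N in suc K , λ { (suc n) (s≤s K≤n) → p n K≤n }

-- Infinite products

∏< : ℕ → (ℕ → FPS) → FPS
∏< zero    F = oneₛ
∏< (suc n) F = ∏< n F *ₛ F n

-- The diagonal of the partial products, which makes `poch a m` an instance by definition. For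
-- `Tame` factors, those with index above N do not affect the N-th coefficient, and the diagonal is
-- the limit.
∏∞ : (ℕ → FPS) → FPS
∏∞ F N = prodTo N F N

Tame : (ℕ → FPS) → Set
Tame F = ∀ i → F i ≈[ i ] oneₛ

prodTo≈∏< : ∀ n F → prodTo n F ≈ ∏< (suc n) F
prodTo≈∏< zero    F = ≈-sym (*ₛ-identityˡ (F 0))
prodTo≈∏< (suc n) F = *ₛ-congʳ (F (suc n)) (prodTo≈∏< n F)

∏<-stable : ∀ {F} → Tame F → ∀ {N} n → N < n → ∏< n F ≈[ N ] ∏< (suc N) F
∏<-stable {F} tame {N} (suc n) (s≤s N≤n) with ℕₚ.m≤n⇒m<n∨m≡n N≤n
... | inj₂ ≡.refl = ≈[]-refl
... | inj₁ N<n    = ≈[]-trans {g = ∏< n F *ₛ oneₛ}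
  (*ₛ-cong[] {f = ∏< n F} ≈[]-refl (≈[]-mono (ℕₚ.<⇒≤ N<n) (tame n)))
  (≈[]-trans {g = ∏< n F} (≈⇒≈[] (*ₛ-identityʳ (∏< n F)))
    (∏<-stable tame n N<n))

∏∞-Lim : ∀ {F} → Tame F → Lim (λ n → ∏< n F) (∏∞ F)
∏∞-Lim {F} tame N = suc N , λ n N<n k k≤N → ≡.trans
  (∏<-stable tame n (ℕₚ.≤-<-trans k≤N N<n) k ℕₚ.≤-refl)
  (≡.sym (at (prodTo≈∏< k F) k))

∏<-cong : ∀ n {F G} → (∀ i → F i ≈ G i) → ∏< n F ≈ ∏< n G
∏<-cong zero    p = ≈-refl
∏<-cong (suc n) p = *ₛ-cong (∏<-cong n p) (p n)

∏<-*ₛ : ∀ n F G → ∏< n F *ₛ ∏< n G ≈ ∏< n (λ i → F i *ₛ G i)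
∏<-*ₛ zero    F G = *ₛ-identityˡ oneₛ
∏<-*ₛ (suc n) F G = ≈-trans
  (solve 4 (λ a b c d → (a :* b) :* (c :* d) := (a :* c) :* (b :* d)) ≈-refl (∏< n F) (F n) (∏< n G) (G n))
  (*ₛ-congʳ (F n *ₛ G n) (∏<-*ₛ n F G))
  where open Solver

∏<-first : ∀ n F → ∏< (suc n) F ≈ F 0 *ₛ ∏< n (F ∘ suc)
∏<-first zero    F = *ₛ-comm oneₛ (F 0)
∏<-first (suc n) F = ≈-trans (*ₛ-congʳ (F (suc n)) (∏<-first n F)) (*ₛ-assoc (F 0) (∏< n (F ∘ suc)) (F (suc n)))

∏<-pairs : ∀ n F → ∏< (n ℕ.+ n) F ≈ ∏< n (λ i → F (i ℕ.+ i) *ₛ F (suc (i ℕ.+ i)))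
∏<-pairs zero    F = ≈-refl
∏<-pairs (suc n) F rewrite ℕₚ.+-suc n n = ≈-trans
  (*ₛ-assoc (∏< (n ℕ.+ n) F) (F (n ℕ.+ n)) (F (suc (n ℕ.+ n))))
  (*ₛ-congʳ (F (n ℕ.+ n) *ₛ F (suc (n ℕ.+ n))) (∏<-pairs n F))

∏∞-cong : ∀ {F G} → (∀ i → F i ≈ G i) → ∏∞ F ≈ ∏∞ G
∏∞-cong {F} {G} p = mk≈ λ n → ≡.trans (at (prodTo≈∏< n F) n)
  (≡.trans (at (∏<-cong (suc n) p) n) (≡.sym (at (prodTo≈∏< n G) n)))

Tame-*ₛ : ∀ {F G} → Tame F → Tame G → Tame (λ i → F i *ₛ G i)
Tame-*ₛ {F} {G} tF tG i = ≈[]-trans {g = oneₛ *ₛ oneₛ} (*ₛ-cong[] {f = F i} {g = G i} (tF i) (tG i))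
                        (≈⇒≈[] (*ₛ-identityˡ oneₛ))

∏∞-*ₛ : ∀ {F G} → Tame F → Tame G → ∏∞ F *ₛ ∏∞ G ≈ ∏∞ (λ i → F i *ₛ G i)
∏∞-*ₛ {F} {G} tF tG = Lim-unique
  (Lim-cong (λ n → ∏<-*ₛ n F G) ≈-refl (Lim-*ₛ (∏∞-Lim tF) (∏∞-Lim tG)))
  (∏∞-Lim (Tame-*ₛ {F} {G} tF tG))

∏∞-first : ∀ {F} → Tame F → Tame (F ∘ suc) → ∏∞ F ≈ F 0 *ₛ ∏∞ (F ∘ suc)
∏∞-first {F} tF tF∘suc = Lim-unique (∏∞-Lim tF) (Lim-unshift
  (Lim-cong (λ n → ≈-sym (∏<-first n F)) ≈-refl (Lim-*ₛ (Lim-const (F 0)) (∏∞-Lim tF∘suc))))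

∏∞-pairs : ∀ {F} → Tame F → Tame (λ i → F (i ℕ.+ i) *ₛ F (suc (i ℕ.+ i))) →
           ∏∞ F ≈ ∏∞ (λ i → F (i ℕ.+ i) *ₛ F (suc (i ℕ.+ i)))
∏∞-pairs {F} tF tFF = Lim-unique
  (Lim-cong (λ n → ∏<-pairs n F) ≈-refl (Lim-subseq (λ n → n ℕ.+ n) (λ n → ℕₚ.m≤m+n n n) (∏∞-Lim tF)))
  (∏∞-Lim tFF)

onePlus : ℤ → ℕ → FPS
onePlus c k = oneₛ +ₛ c · mono k

poch⁺ : ℤ → ℕ → ℕ → FPS
poch⁺ c a m = ∏∞ (λ i → onePlus c (a ℕ.+ m ℕ.* i))

onePlus-≈[] : ∀ c {k N} → N < k → onePlus c k ≈[ N ] oneₛ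
onePlus-≈[] c {k} N<k n n≤N rewrite mono-≈[]-0 {k} N<k n n≤N | ℤₚ.*-zeroʳ c = ℤₚ.+-identityʳ (oneₛ n)

n<a+mn : ∀ {a m} → 1 ≤ a → 1 ≤ m → ∀ n → n < a ℕ.+ m ℕ.* n
n<a+mn {a} {m} 1≤a 1≤m n = ℕₚ.+-mono-≤ 1≤a (ℕₚ.≤-trans (ℕₚ.≤-reflexive (≡.sym (ℕₚ.*-identityˡ n))) (ℕₚ.*-monoˡ-≤ n 1≤m))

onePlus-tame : ∀ c {a m} → 1 ≤ a → 1 ≤ m → Tame (λ i → onePlus c (a ℕ.+ m ℕ.* i))
onePlus-tame c 1≤a 1≤m i = onePlus-≈[] c (n<a+mn 1≤a 1≤m i)

oneMinus≈onePlus : ∀ k → oneMinus k ≈ onePlus -1ℤ k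
oneMinus≈onePlus k = mk≈ λ n → cong (_+_ (oneₛ n)) (≡.sym (ℤₚ.-1*i≡-i (mono k n)))

poch≈poch⁺ : ∀ a m → poch a m ≈ poch⁺ -1ℤ a m
poch≈poch⁺ a m = ∏∞-cong λ i → oneMinus≈onePlus (a ℕ.+ m ℕ.* i)

poch⁺-step : ∀ c a m → 1 ≤ a → 1 ≤ m → poch⁺ c a m ≈ onePlus c a *ₛ poch⁺ c (a ℕ.+ m) m
poch⁺-step c a m 1≤a 1≤m = ≈-trans
  (∏∞-first {F} (onePlus-tame c 1≤a 1≤m) (λ i n n≤i → onePlus-tame c 1≤a 1≤m (suc i) n (ℕₚ.m≤n⇒m≤1+n n≤i)))
  (*ₛ-cong (≡⇒≈ (cong (onePlus c) (≡.trans (cong (a ℕ.+_) (ℕₚ.*-zeroʳ m)) (ℕₚ.+-identityʳ a))))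
           (∏∞-cong λ i → ≡⇒≈ (cong (onePlus c)
             (≡.trans (cong (a ℕ.+_) (ℕₚ.*-suc m i)) (≡.sym (ℕₚ.+-assoc a m (m ℕ.* i)))))))
  where
  F : ℕ → FPS
  F i = onePlus c (a ℕ.+ m ℕ.* i)

-- Factors of even and of odd index. In the final computation this brings the products of base q⁵ to
-- the base q¹⁰ of `x₁`.
poch⁺-split : ∀ c a m → 1 ≤ a → 1 ≤ m →
              poch⁺ c a m ≈ poch⁺ c a (m ℕ.+ m) *ₛ poch⁺ c (a ℕ.+ m) (m ℕ.+ m)
poch⁺-split c a m 1≤a 1≤m = ≈-trans (∏∞-pairs {F} tF tFF)
  (≈-trans (∏∞-cong {λ i → F (i ℕ.+ i) *ₛ F (suc (i ℕ.+ i))} λ i → *ₛ-cong (even i) (odd i)) (≈-sym (∏∞-*ₛ tG tH)))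
  where
  F G H : ℕ → FPS
  F i = onePlus c (a ℕ.+ m ℕ.* i)
  G i = onePlus c (a ℕ.+ (m ℕ.+ m) ℕ.* i)
  H i = onePlus c (a ℕ.+ m ℕ.+ (m ℕ.+ m) ℕ.* i)
  tF : Tame F
  tF = onePlus-tame c 1≤a 1≤m
  tG : Tame G
  tG = onePlus-tame c 1≤a (ℕₚ.≤-trans 1≤m (ℕₚ.m≤m+n m m))
  tH : Tame H
  tH = onePlus-tame c (ℕₚ.≤-trans 1≤a (ℕₚ.m≤m+n a m)) (ℕₚ.≤-trans 1≤m (ℕₚ.m≤m+n m m))
  tFF : Tame (λ i → F (i ℕ.+ i) *ₛ F (suc (i ℕ.+ i)))
  tFF = Tame-*ₛ {λ i → F (i ℕ.+ i)} {λ i → F (suc (i ℕ.+ i))}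
    (λ i → ≈[]-mono (ℕₚ.m≤m+n i i) (tF (i ℕ.+ i)))
    (λ i → ≈[]-mono (ℕₚ.m≤n⇒m≤1+n (ℕₚ.m≤m+n i i)) (tF (suc (i ℕ.+ i))))
  open +-*-Solver
  even : ∀ i → F (i ℕ.+ i) ≈ G i
  even i = ≡⇒≈ (cong (onePlus c)
    (solve 3 (λ a m i → a :+ m :* (i :+ i) := a :+ (m :+ m) :* i) ≡.refl a m i))
  odd : ∀ i → F (suc (i ℕ.+ i)) ≈ H i
  odd i = ≡⇒≈ (cong (onePlus c)
    (solve 3 (λ a m i → a :+ m :* (con 1 :+ (i :+ i)) := a :+ m :+ (m :+ m) :* i) ≡.refl a m i))

onePlus-conj : ∀ k → onePlus 1ℤ k *ₛ onePlus -1ℤ k ≈ onePlus -1ℤ (k ℕ.+ k)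
onePlus-conj k = ≈-trans
  (*ₛ-cong (+ₛ-congˡ oneₛ (mk≈ λ n → ℤₚ.*-identityˡ (mono k n)))
           (+ₛ-congˡ oneₛ (mk≈ λ n → ℤₚ.-1*i≡-i (mono k n))))
  (≈-trans (solve 2 (λ u x → (u :+ x) :* (u :+ :- x) := u :* u :+ :- (x :* x)) ≈-refl oneₛ (mono k))
    (+ₛ-cong (*ₛ-identityˡ oneₛ) (mk≈ λ n → ≡.trans (cong -_ (at (mono-*ₛ-mono k k) n))
                                      (≡.sym (ℤₚ.-1*i≡-i (mono (k ℕ.+ k) n))))))
  where open Solver

-- Theta series as sums over lattices

private variable
  I J K : Set

∑ : List I → (I → ℤ) → ℤ
∑ []      g = 0ℤ
∑ (i ∷ L) g = g i + ∑ L g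

∑-↭ : ∀ (g : I → ℤ) {L M} → L ↭ M → ∑ L g ≡ ∑ M g
∑-↭ g ↭.refl         = ≡.refl
∑-↭ g (↭.prep i p)   = cong (_+_ (g i)) (∑-↭ g p)
∑-↭ g {M = _ ∷ _ ∷ M} (↭.swap i j p) rewrite ∑-↭ g p = exchange (g i) (g j) (∑ M g)
  where
  exchange : ∀ a b c → a + (b + c) ≡ b + (a + c)
  exchange = solve-∀
∑-↭ g (↭.trans p r)  = ≡.trans (∑-↭ g p) (∑-↭ g r)

module _ (g : I → ℤ) where

  private
    nonzero? : ∀ i → _
    nonzero? i = ¬? (g i ℤ.≟ 0ℤ)

  ∑-nonzero : ∀ L → ∑ L g ≡ ∑ (filter nonzero? L) g
  ∑-nonzero [] = ≡.refl
  ∑-nonzero (i ∷ L) with g i ℤ.≟ 0ℤ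
  ... | yes gᵢ≡0 = ≡.trans (cong₂ _+_ gᵢ≡0 (∑-nonzero L)) (ℤₚ.+-identityˡ _)
  ... | no  _    = cong (_+_ (g i)) (∑-nonzero L)

  -- Once zero terms are dropped, both lists enumerate the support without repetition, hence are
  -- permutations of each other.
  ∑-support : ∀ {L M} → Unique L → Unique M →
              (∀ i → g i ≢ 0ℤ → i ∈ L) → (∀ i → g i ≢ 0ℤ → i ∈ M) → ∑ L g ≡ ∑ M g
  ∑-support {L} {M} uL uM inL inM = begin
    ∑ L g                    ≡⟨ ∑-nonzero L ⟩
    ∑ (filter nonzero? L) g  ≡⟨ ∑-↭ g (∼bag⇒↭ (unique∧set⇒bag (Unique.filter⁺ nonzero? uL)
                                 (Unique.filter⁺ nonzero? uM) (mk⇔ (move L inM) (move M inL)))) ⟩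
    ∑ (filter nonzero? M) g  ≡⟨ ∑-nonzero M ⟨
    ∑ M g                    ∎
    where
    open ≡.≡-Reasoning
    move : ∀ L {M i} → (∀ i → g i ≢ 0ℤ → i ∈ M) → i ∈ filter nonzero? L → i ∈ filter nonzero? M
    move L inM i∈ = let (_ , gᵢ≢0) = ∈-filter⁻ nonzero? {xs = L} i∈ in ∈-filter⁺ nonzero? (inM _ gᵢ≢0) gᵢ≢0

∑ₛ : List I → (I → FPS) → FPS
∑ₛ L F n = ∑ L (λ i → F i n)

∑ₛ-cong : ∀ (L : List I) {F G : I → FPS} → (∀ i → F i ≈ G i) → ∑ₛ L F ≈ ∑ₛ L G
∑ₛ-cong []      p = ≈-refl
∑ₛ-cong (i ∷ L) p = +ₛ-cong (p i) (∑ₛ-cong L p)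

∑ₛ-cong[] : ∀ (L : List I) {N} {F G : I → FPS} → (∀ i → F i ≈[ N ] G i) → ∑ₛ L F ≈[ N ] ∑ₛ L G
∑ₛ-cong[] []      p = λ _ _ → ≡.refl
∑ₛ-cong[] (i ∷ L) p n n≤N = cong₂ _+_ (p i n n≤N) (∑ₛ-cong[] L p n n≤N)

∑ₛ-map : ∀ (σ : J → I) L (F : I → FPS) → ∑ₛ (map σ L) F ≈ ∑ₛ L (F ∘ σ)
∑ₛ-map σ []      F = ≈-refl
∑ₛ-map σ (j ∷ L) F = +ₛ-congˡ (F (σ j)) (∑ₛ-map σ L F)

∑ₛ-++ : ∀ (L M : List I) (F : I → FPS) → ∑ₛ (L ++ M) F ≈ ∑ₛ L F +ₛ ∑ₛ M F
∑ₛ-++ []      M F = mk≈ λ n → ≡.sym (ℤₚ.+-identityˡ (∑ₛ M F n))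
∑ₛ-++ (i ∷ L) M F = mk≈ λ n → ≡.trans (cong (_+_ (F i n)) (at (∑ₛ-++ L M F) n))
                                      (≡.sym (ℤₚ.+-assoc (F i n) (∑ₛ L F n) (∑ₛ M F n)))

∑ₛ-*ₛ : ∀ (L : List I) (F : I → FPS) g → ∑ₛ L F *ₛ g ≈ ∑ₛ L (λ i → F i *ₛ g)
∑ₛ-*ₛ []      F g = zeroₛ-*ₛ g
∑ₛ-*ₛ (i ∷ L) F g = ≈-trans (*ₛ-distribʳ g (F i) (∑ₛ L F)) (+ₛ-congˡ (F i *ₛ g) (∑ₛ-*ₛ L F g))

*ₛ-∑ₛ : ∀ (L : List I) (F : I → FPS) g → g *ₛ ∑ₛ L F ≈ ∑ₛ L (λ i → g *ₛ F i)
*ₛ-∑ₛ L F g = ≈-trans (*ₛ-comm g (∑ₛ L F)) (≈-trans (∑ₛ-*ₛ L F g) (∑ₛ-cong L λ i → *ₛ-comm (F i) g))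

∑ₛ-× : ∀ (L : List I) (M : List J) (F : I × J → FPS) →
       ∑ₛ (cartesianProduct L M) F ≈ ∑ₛ L (λ i → ∑ₛ M (λ j → F (i , j)))
∑ₛ-× []      M F = ≈-refl
∑ₛ-× (i ∷ L) M F = ≈-trans (∑ₛ-++ (map (i ,_) M) (cartesianProduct L M) F)
  (+ₛ-cong (∑ₛ-map (i ,_) M F) (∑ₛ-× L M F))

term : (I → ℤ) → (I → ℕ) → I → FPS
term w e i = w i · mono (e i)

-- Indices of larger exponent are allowed in the list, since they do not reach the coefficients up
-- to `N`. Hence intervals and boxes can serve as covers.
record Covers (e : I → ℕ) (N : ℕ) (L : List I) : Set where
  constructor covers
  field
    unique   : Unique L
    complete : ∀ i → e i ≤ N → i ∈ L

-- S = ∑_i w i q^(e i), where each exponent is taken finitely often.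
record Sums (w : I → ℤ) (e : I → ℕ) (S : FPS) : Set where
  constructor sums
  field
    cover    : ℕ → List I
    isCover  : ∀ N → Covers e N (cover N)
    value    : ∀ N → ∑ₛ (cover N) (term w e) N ≡ S N

open Covers
open Sums

term-support : ∀ (w : I → ℤ) e {N L} → Covers e N L → ∀ i → term w e i N ≢ 0ℤ → i ∈ L
term-support w e {N} c i t≢0 with N ℕ.≟ e i
... | yes N≡e = complete c i (ℕₚ.≤-reflexive (≡.sym N≡e))
... | no  _   = ⊥-elim (t≢0 (ℤₚ.*-zeroʳ (w i)))

Covers-mono : ∀ {e : I → ℕ} {M N L} → M ≤ N → Covers e N L → Covers e M L
Covers-mono M≤N (covers u c) = covers u λ i e≤M → c i (ℕₚ.≤-trans e≤M M≤N)

module _ {w : I → ℤ} {e : I → ℕ} {S : FPS} where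

  Sums-eval : Sums w e S → ∀ {N L} → Covers e N L → ∑ₛ L (term w e) ≈[ N ] S
  Sums-eval s c n n≤N = ≡.trans
    (∑-support (λ i → term w e i n) (unique c) (unique (isCover s n))
      (term-support w e (Covers-mono n≤N c)) (term-support w e (isCover s n)))
    (value s n)

  -- The source of the theta identities: both sides are exhibited as sums of one and the same
  -- weighted family.
  Sums-unique : ∀ {S′} → Sums w e S → Sums w e S′ → S ≈ S′
  Sums-unique s s′ = mk≈ λ N → ≡.trans (≡.sym (Sums-eval s (isCover s′ N) N ℕₚ.≤-refl)) (value s′ N)

  Sums-≈ : ∀ {S′} → S ≈ S′ → Sums w e S → Sums w e S′
  Sums-≈ p s = sums (cover s) (isCover s) λ N → ≡.trans (value s N) (at p N)

  Sums-reindex : ∀ {w′ : J → ℤ} {e′ : J → ℕ} (σ : J → I) (τ : I → J) →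
                 (∀ i → σ (τ i) ≡ i) → (∀ j → τ (σ j) ≡ j) →
                 (∀ j → w (σ j) ≡ w′ j) → (∀ j → e (σ j) ≡ e′ j) →
                 Sums w e S → Sums w′ e′ S
  Sums-reindex {w′ = w′} {e′} σ τ στ τσ w≡ e≡ s = sums (λ N → map τ (cover s N)) isCover′ value′
    where
    isCover′ : ∀ N → Covers e′ N (map τ (cover s N))
    isCover′ N = covers
      (Unique.map⁺ (λ {i} {j} p → ≡.trans (≡.sym (στ i)) (≡.trans (cong σ p) (στ j))) (unique (isCover s N)))
      (λ j e≤N → subst (_∈ map τ (cover s N)) (τσ j)
        (∈-map⁺ τ (complete (isCover s N) (σ j) (ℕₚ.≤-trans (ℕₚ.≤-reflexive (e≡ j)) e≤N))))
    value′ : ∀ N → ∑ₛ (map τ (cover s N)) (term w′ e′) N ≡ S N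
    value′ N = ≡.trans (at (≈-trans (∑ₛ-map τ (cover s N) (term w′ e′)) (∑ₛ-cong (cover s N) same)) N) (value s N)
      where
      same : ∀ i → term w′ e′ (τ i) ≈ term w e i
      same i = ≡⇒≈ (cong₂ (λ c k → c · mono k)
        (≡.trans (≡.sym (w≡ (τ i))) (cong w (στ i))) (≡.trans (≡.sym (e≡ (τ i))) (cong e (στ i))))

  Sums-shift : ∀ c k → Sums w e S → Sums (λ i → c * w i) (λ i → k ℕ.+ e i) ((c · mono k) *ₛ S)
  Sums-shift c k s = sums (cover s)
    (λ N → covers (unique (isCover s N)) λ i k+e≤N → complete (isCover s N) i (ℕₚ.m+n≤o⇒n≤o k k+e≤N))
    (λ N → ≡.trans
      (at (≈-sym (≈-trans (*ₛ-∑ₛ (cover s N) (term w e) (c · mono k)) (∑ₛ-cong (cover s N) same))) N)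
      (*ₛ-cong[] {f = c · mono k} ≈[]-refl (Sums-eval s (isCover s N)) N ℕₚ.≤-refl))
    where
    same : ∀ i → (c · mono k) *ₛ term w e i ≈ (c * w i) · mono (k ℕ.+ e i)
    same i = ≈-trans (·-*ₛ-· c (w i) (mono k) (mono (e i))) (·-cong {c * w i} ≡.refl (mono-*ₛ-mono k (e i)))

module _ {w : I → ℤ} {e : I → ℕ} {S : FPS} {w′ : J → ℤ} {e′ : J → ℕ} {S′ : FPS} where

  Sums-× : Sums w e S → Sums w′ e′ S′ →
           Sums (λ (ij : I × J) → w (proj₁ ij) * w′ (proj₂ ij)) (λ ij → e (proj₁ ij) ℕ.+ e′ (proj₂ ij)) (S *ₛ S′)
  Sums-× s s′ = sums box isCover″ value″
    where
    w″ : I × J → ℤ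
    w″ (i , j) = w i * w′ j
    e″ : I × J → ℕ
    e″ (i , j) = e i ℕ.+ e′ j
    box : ℕ → List (I × J)
    box N = cartesianProduct (cover s N) (cover s′ N)
    isCover″ : ∀ N → Covers e″ N (box N)
    isCover″ N = covers (Unique.cartesianProduct⁺ (unique (isCover s N)) (unique (isCover s′ N)))
      λ (i , j) e+e′≤N → ∈-cartesianProduct⁺ (complete (isCover s N) i (ℕₚ.m+n≤o⇒m≤o (e i) e+e′≤N))
                                             (complete (isCover s′ N) j (ℕₚ.m+n≤o⇒n≤o (e i) e+e′≤N))
    value″ : ∀ N → ∑ₛ (box N) (term w″ e″) N ≡ (S *ₛ S′) N
    value″ N = ≡.sym (≡.trans
      (≡.sym (*ₛ-cong[] (Sums-eval s (isCover s N)) (Sums-eval s′ (isCover s′ N)) N ℕₚ.≤-refl))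
      (at (≈-trans (∑ₛ-*ₛ L (term w e) (∑ₛ M (term w′ e′)))
          (≈-trans (∑ₛ-cong L λ i → ≈-trans (*ₛ-∑ₛ M (term w′ e′) (term w e i)) (∑ₛ-cong M (same i)))
                   (≈-sym (∑ₛ-× L M (term w″ e″))))) N))
      where
      L = cover s N
      M = cover s′ N
      same : ∀ i j → term w e i *ₛ term w′ e′ j ≈ term w″ e″ (i , j)
      same i j = ≈-trans (·-*ₛ-· (w i) (w′ j) (mono (e i)) (mono (e′ j)))
                         (·-cong {w i * w′ j} ≡.refl (mono-*ₛ-mono (e i) (e′ j)))

  Sums-⊎ : Sums w e S → Sums w′ e′ S′ → Sums [ w , w′ ] [ e , e′ ] (S +ₛ S′)
  Sums-⊎ s s′ = sums union isCover″ value″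
    where
    union : ℕ → List (I ⊎ J)
    union N = map inj₁ (cover s N) ++ map inj₂ (cover s′ N)
    isCover″ : ∀ N → Covers [ e , e′ ] N (union N)
    isCover″ N = covers
      (Unique.++⁺ (Unique.map⁺ inj₁-injective (unique (isCover s N)))
                  (Unique.map⁺ inj₂-injective (unique (isCover s′ N))) disjoint)
      λ { (inj₁ i) e≤N → ∈-++⁺ˡ (∈-map⁺ inj₁ (complete (isCover s N) i e≤N))
        ; (inj₂ j) e≤N → ∈-++⁺ʳ (map inj₁ (cover s N)) (∈-map⁺ inj₂ (complete (isCover s′ N) j e≤N)) }
      where
      disjoint : ∀ {k} → ¬ (k ∈ map inj₁ (cover s N) × k ∈ map inj₂ (cover s′ N))
      disjoint (p , r) with ∈-map⁻ inj₁ p | ∈-map⁻ inj₂ r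
      ... | _ , _ , ≡.refl | _ , _ , ()
    value″ : ∀ N → ∑ₛ (union N) (term [ w , w′ ] [ e , e′ ]) N ≡ (S +ₛ S′) N
    value″ N = ≡.trans
      (at (≈-trans (∑ₛ-++ (map inj₁ (cover s N)) (map inj₂ (cover s′ N)) (term [ w , w′ ] [ e , e′ ]))
            (+ₛ-cong (∑ₛ-map inj₁ (cover s N) _) (∑ₛ-map inj₂ (cover s′ N) _))) N)
      (cong₂ _+_ (value s N) (value s′ N))

∑Fin : ∀ n → (Fin n → FPS) → FPS
∑Fin zero    S = zeroₛ
∑Fin (suc n) S = S zero +ₛ ∑Fin n (S ∘ suc)

Sums-Fin : ∀ n {w : Fin n × K → ℤ} {e : Fin n × K → ℕ} {S : Fin n → FPS} →
           (∀ r → Sums (λ k → w (r , k)) (λ k → e (r , k)) (S r)) → Sums w e (∑Fin n S)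
Sums-Fin zero    s = sums (λ _ → []) (λ _ → covers [] λ ()) (λ _ → ≡.refl)
Sums-Fin (suc n) {w} {e} s = Sums-reindex
  (λ { (zero , k) → inj₁ k ; (suc r , k) → inj₂ (r , k) })
  [ (zero ,_) , (λ (r , k) → suc r , k) ]
  (λ { (inj₁ k) → ≡.refl ; (inj₂ (r , k)) → ≡.refl })
  (λ { (zero , k) → ≡.refl ; (suc r , k) → ≡.refl })
  (λ { (zero , k) → ≡.refl ; (suc r , k) → ≡.refl })
  (λ { (zero , k) → ≡.refl ; (suc r , k) → ≡.refl })
  (Sums-⊎ (s zero) (Sums-Fin n (s ∘ suc)))

-- Signs, exponents and Ramanujan's theta series

record Character (s : ℤ → ℤ) : Set where
  field
    homo   : ∀ m n → s (m + n) ≡ s m * s n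
    square : ∀ n → s n * s n ≡ 1ℤ

  at-0 : s 0ℤ ≡ 1ℤ
  at-0 = ≡.trans (homo 0ℤ 0ℤ) (square 0ℤ)

  -- A character with values of square 1 is n ↦ ε^n with ε = ±1, so it is even. The reflection n ↦
  -- -n of a theta series therefore leaves the signs alone.
  at-neg : ∀ n → s (- n) ≡ s n
  at-neg n = begin
    s (- n)                ≡⟨ ℤₚ.*-identityˡ (s (- n)) ⟨
    1ℤ * s (- n)           ≡⟨ cong (_* s (- n)) (square n) ⟨
    s n * s n * s (- n)    ≡⟨ ℤₚ.*-assoc (s n) (s n) (s (- n)) ⟩
    s n * (s n * s (- n))  ≡⟨ cong (s n *_) (homo n (- n)) ⟨
    s n * s (n - n)        ≡⟨ cong (λ k → s n * s k) (ℤₚ.+-inverseʳ n) ⟩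
    s n * s 0ℤ             ≡⟨ cong (s n *_) at-0 ⟩
    s n * 1ℤ               ≡⟨ ℤₚ.*-identityʳ (s n) ⟩
    s n                    ∎
    where open ≡.≡-Reasoning

triv : ℤ → ℤ
triv _ = 1ℤ

triv-character : Character triv
triv-character = record { homo = λ _ _ → ≡.refl ; square = λ _ → ≡.refl }

altℕ : ℕ → ℤ
altℕ zero    = 1ℤ
altℕ (suc n) = - altℕ n

alt : ℤ → ℤ
alt n = altℕ ∣ n ∣

altℕ-square : ∀ n → altℕ n * altℕ n ≡ 1ℤ
altℕ-square zero    = ≡.refl
altℕ-square (suc n) = ≡.trans (neg-square (altℕ n)) (altℕ-square n)
  where
  neg-square : ∀ x → - x * - x ≡ x * x
  neg-square = solve-∀

alt-suc : ∀ n → alt (1ℤ + n) ≡ - alt n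
alt-suc (+ n)        = ≡.refl
alt-suc -[1+ zero ]  = ≡.refl
alt-suc -[1+ suc n ] = ≡.sym (ℤₚ.neg-involutive _)

alt-character : Character alt
alt-character = record { homo = homo ; square = λ n → altℕ-square ∣ n ∣ }
  where
  homo⁺ : ∀ m n → alt (+ m + n) ≡ altℕ m * alt n
  homo⁺ zero    n = ≡.trans (cong alt (ℤₚ.+-identityˡ n)) (≡.sym (ℤₚ.*-identityˡ (alt n)))
  homo⁺ (suc m) n = begin
    alt (1ℤ + + m + n)    ≡⟨ cong alt (ℤₚ.+-assoc 1ℤ (+ m) n) ⟩
    alt (1ℤ + (+ m + n))  ≡⟨ alt-suc (+ m + n) ⟩
    - alt (+ m + n)       ≡⟨ cong -_ (homo⁺ m n) ⟩
    - (altℕ m * alt n)    ≡⟨ ℤₚ.neg-distribˡ-* (altℕ m) (alt n) ⟩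
    - altℕ m * alt n      ∎
    where open ≡.≡-Reasoning
  homo : ∀ m n → alt (m + n) ≡ alt m * alt n
  homo (+ m)      n = homo⁺ m n
  homo -[1+ m ] n = begin
    alt (-[1+ m ] + n)                      ≡⟨ ℤₚ.*-identityˡ _ ⟨
    1ℤ * alt (-[1+ m ] + n)                 ≡⟨ cong (_* alt (-[1+ m ] + n)) (altℕ-square (suc m)) ⟨
    altℕ (suc m) * altℕ (suc m) * alt (-[1+ m ] + n)    ≡⟨ ℤₚ.*-assoc (altℕ (suc m)) (altℕ (suc m)) _ ⟩
    altℕ (suc m) * (altℕ (suc m) * alt (-[1+ m ] + n))  ≡⟨ cong (altℕ (suc m) *_) (homo⁺ (suc m) (-[1+ m ] + n)) ⟨
    altℕ (suc m) * alt (+ suc m + (-[1+ m ] + n))       ≡⟨ cong (λ k → altℕ (suc m) * alt k) (cancel (+ suc m) n) ⟩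
    altℕ (suc m) * alt n                    ∎
    where
    open ≡.≡-Reasoning
    cancel : ∀ m n → m + (- m + n) ≡ n
    cancel = solve-∀

triℕ : ℕ → ℕ
triℕ zero    = 0
triℕ (suc n) = n ℕ.+ triℕ n

-- n (n - 1) / 2
tri : ℤ → ℕ
tri (+ n)    = triℕ n
tri -[1+ n ] = triℕ (suc (suc n))

double-triℕ : ∀ n → + 2 * + triℕ n ≡ + n * (+ n - 1ℤ)
double-triℕ zero    = ≡.refl
double-triℕ (suc n) = ≡.trans (ℤₚ.*-distribˡ-+ (+ 2) (+ n) (+ triℕ n))
  (≡.trans (cong (_+_ (+ 2 * + n)) (double-triℕ n)) (step (+ n)))
  where
  step : ∀ n → + 2 * n + n * (n - 1ℤ) ≡ (1ℤ + n) * (1ℤ + n - 1ℤ)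
  step = solve-∀

double-tri : ∀ n → + 2 * + tri n ≡ n * (n - 1ℤ)
double-tri (+ n)    = double-triℕ n
double-tri -[1+ n ] = ≡.trans (double-triℕ (suc (suc n))) (flip (+ n))
  where
  flip : ∀ n → (1ℤ + (1ℤ + n)) * (1ℤ + (1ℤ + n) - 1ℤ) ≡ - (1ℤ + n) * (- (1ℤ + n) - 1ℤ)
  flip = solve-∀

-- The exponent of q in the n-th term of Ramanujan's f(q^a, q^b).
expo : ℕ → ℕ → ℤ → ℕ
expo a b n = a ℕ.* tri (1ℤ + n) ℕ.+ b ℕ.* tri n

-- Doubling clears the halves in the triangular numbers. Together with `double-injective` it turns
-- each comparison of exponents into a polynomial identity over ℤ.
double-expo : ∀ a b n → + 2 * + expo a b n ≡ (+ a + + b) * (n * n) + (+ a - + b) * n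
double-expo a b n = begin
  + 2 * + expo a b n
    ≡⟨ cong₂ (λ x y → + 2 * (x + y)) (ℤₚ.pos-* a _) (ℤₚ.pos-* b _) ⟩
  + 2 * (+ a * + tri (1ℤ + n) + + b * + tri n)
    ≡⟨ push (+ a) (+ b) (+ tri (1ℤ + n)) (+ tri n) ⟩
  + a * (+ 2 * + tri (1ℤ + n)) + + b * (+ 2 * + tri n)
    ≡⟨ cong₂ (λ x y → + a * x + + b * y) (double-tri (1ℤ + n)) (double-tri n) ⟩
  + a * ((1ℤ + n) * (1ℤ + n - 1ℤ)) + + b * (n * (n - 1ℤ))
    ≡⟨ collect (+ a) (+ b) n ⟩
  (+ a + + b) * (n * n) + (+ a - + b) * n ∎
  where
  open ≡.≡-Reasoning
  push : ∀ a b x y → + 2 * (a * x + b * y) ≡ a * (+ 2 * x) + b * (+ 2 * y)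
  push = solve-∀
  collect : ∀ a b n → a * ((1ℤ + n) * (1ℤ + n - 1ℤ)) + b * (n * (n - 1ℤ)) ≡ (a + b) * (n * n) + (a - b) * n
  collect = solve-∀

double-injective : ∀ {m n} → + 2 * + m ≡ + 2 * + n → m ≡ n
double-injective p = ℤₚ.+-injective (ℤₚ.*-cancelˡ-≡ (+ 2) _ _ p)

∣n∣≤1+tri : ∀ n → ∣ n ∣ ≤ suc (tri (1ℤ + n))
∣n∣≤1+tri (+ n)        = ℕₚ.m≤n⇒m≤1+n (ℕₚ.m≤m+n n (triℕ n))
∣n∣≤1+tri -[1+ zero ]  = s≤s z≤n
∣n∣≤1+tri -[1+ suc n ] = s≤s (ℕₚ.m≤m+n (suc n) (triℕ (suc n)))

-- The `suc` matters when `b = 0`, as in `ψ`: there the index -1 already has exponent 0. It is also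
-- the reason why `Θ` sums over `interval (suc N)`.
∣n∣≤1+expo : ∀ {a} b → 1 ≤ a → ∀ n → ∣ n ∣ ≤ suc (expo a b n)
∣n∣≤1+expo {a} b 1≤a n = ℕₚ.≤-trans (∣n∣≤1+tri n) (s≤s (begin
  tri (1ℤ + n)           ≡⟨ ℕₚ.*-identityˡ _ ⟨
  1 ℕ.* tri (1ℤ + n)     ≤⟨ ℕₚ.*-monoˡ-≤ (tri (1ℤ + n)) 1≤a ⟩
  a ℕ.* tri (1ℤ + n)     ≤⟨ ℕₚ.m≤m+n _ _ ⟩
  expo a b n             ∎))
  where open ℕₚ.≤-Reasoning

interval : ℕ → List ℤ
interval M = map +_ (downFrom (suc M)) ++ map -[1+_] (downFrom M)

interval-unique : ∀ M → Unique (interval M)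
interval-unique M = Unique.++⁺ (Unique.map⁺ ℤₚ.+-injective (Unique.downFrom⁺ (suc M)))
                               (Unique.map⁺ ℤₚ.-[1+-injective (Unique.downFrom⁺ M)) disjoint
  where
  disjoint : ∀ {k} → ¬ (k ∈ map +_ (downFrom (suc M)) × k ∈ map -[1+_] (downFrom M))
  disjoint (p , r) with ∈-map⁻ +_ p | ∈-map⁻ -[1+_] r
  ... | _ , _ , ≡.refl | _ , _ , ()

∈-interval : ∀ {M} n → ∣ n ∣ ≤ M → n ∈ interval M
∈-interval     (+ n)    n≤M = ∈-++⁺ˡ (∈-map⁺ +_ (∈-downFrom⁺ (s≤s n≤M)))
∈-interval {M} -[1+ n ] n<M = ∈-++⁺ʳ (map +_ (downFrom (suc M))) (∈-map⁺ -[1+_] (∈-downFrom⁺ n<M))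

-- Ramanujan's f(εq^a, εq^b), where s n = ε^n.
Θ : (ℤ → ℤ) → ℕ → ℕ → FPS
Θ s a b N = ∑ₛ (interval (suc N)) (term s (expo a b)) N

Sums-Θ : ∀ s a b → 1 ≤ a → Sums s (expo a b) (Θ s a b)
Sums-Θ s a b 1≤a = sums (interval ∘ suc)
  (λ N → covers (interval-unique (suc N)) λ n e≤N → ∈-interval n (ℕₚ.≤-trans (∣n∣≤1+expo b 1≤a n) (s≤s e≤N)))
  (λ N → ≡.refl)

Θ-sym : ∀ {s} → Character s → ∀ a b → 1 ≤ a → 1 ≤ b → Θ s a b ≈ Θ s b a
Θ-sym {s} χ a b 1≤a 1≤b = Sums-unique
  (Sums-reindex -_ -_ ℤₚ.neg-involutive ℤₚ.neg-involutive (Character.at-neg χ) flip (Sums-Θ s a b 1≤a))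
  (Sums-Θ s b a 1≤b)
  where
  poly : ∀ a b n → (a + b) * (- n * - n) + (a - b) * - n ≡ (b + a) * (n * n) + (b - a) * n
  poly = solve-∀
  flip : ∀ n → expo a b (- n) ≡ expo b a n
  flip n = double-injective (≡.trans (double-expo a b (- n)) (≡.trans (poly (+ a) (+ b) n) (≡.sym (double-expo b a n))))

-- Splitting ℤ² into residue classes

divMod-unique : ∀ {d r r′} h h′ → r < d → r′ < d → + r + h * + d ≡ + r′ + h′ * + d → r ≡ r′ × h ≡ h′
divMod-unique {d} {r} {r′} h h′ r<d r′<d eq = r≡r′ , h≡h′
  where
  cross : ∀ r h r′ h′ d → r + h * d ≡ r′ + h′ * d → r - r′ ≡ (h′ - h) * d
  cross r h r′ h′ d p = ≡.trans (lhs r h r′ d) (≡.trans (cong (λ x → x - r′ - h * d) p) (rhs r′ h h′ d))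
    where
    lhs : ∀ r h r′ d → r - r′ ≡ r + h * d - r′ - h * d
    lhs = solve-∀
    rhs : ∀ r′ h h′ d → r′ + h′ * d - r′ - h * d ≡ (h′ - h) * d
    rhs = solve-∀
  gap : ∣ r ⊖ r′ ∣ ≡ ∣ h′ - h ∣ ℕ.* d
  gap = ≡.trans (cong ∣_∣ (≡.trans (≡.sym (ℤₚ.m-n≡m⊖n r r′)) (cross (+ r) h (+ r′) h′ (+ d) eq)))
                (ℤₚ.abs-* (h′ - h) (+ d))
  small : ∀ k → k ℕ.* d < d → k ≡ 0
  small zero    _  = ≡.refl
  small (suc k) lt = ⊥-elim (ℕₚ.<⇒≱ lt (ℕₚ.m≤m+n d (k ℕ.* d)))
  zero-gap : ∣ h′ - h ∣ ≡ 0
  zero-gap = small _ (ℕₚ.≤-<-trans (ℕₚ.≤-reflexive (≡.sym gap))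
                       (ℕₚ.≤-<-trans (ℤₚ.∣m⊝n∣≤m⊔n r r′) (ℕₚ.⊔-lub r<d r′<d)))
  h≡h′ : h ≡ h′
  h≡h′ = ≡.sym (ℤₚ.i-j≡0⇒i≡j h′ h (ℤₚ.∣i∣≡0⇒i≡0 zero-gap))
  r≡r′ : r ≡ r′
  r≡r′ = ℤₚ.+-injective (ℤₚ.i-j≡0⇒i≡j (+ r) (+ r′)
    (≡.trans (ℤₚ.m-n≡m⊖n r r′) (ℤₚ.∣i∣≡0⇒i≡0 (≡.trans gap (cong (ℕ._* d) zero-gap)))))

-- Splits the plane according to the residue r of m + c n modulo d, where m + c n = r + h d.
residue : ∀ d → ℤ → Fin d → ℤ × ℤ → ℤ × ℤ
residue d c r (h , n) = (+ toℕ r + h * + d - c * n , n)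

-- Division of m + c n by `d` with remainder, with n kept, inverts `residue`. Each class is again
-- parametrised by a full plane, so each part can be recognised as a product of theta series.
Sums-residues : ∀ d .{{_ : ℕ.NonZero d}} c {w : ℤ × ℤ → ℤ} {e : ℤ × ℤ → ℕ} {S : Fin d → FPS} →
                (∀ r → Sums (w ∘ residue d c r) (e ∘ residue d c r) (S r)) → Sums w e (∑Fin d S)
Sums-residues d c {w} {e} s = Sums-reindex σ τ στ τσ (λ j → cong w (τσ j)) (λ j → cong e (τσ j)) (Sums-Fin d s)
  where
  κ : ℤ × ℤ → ℤ
  κ (m , n) = m + c * n
  τ : Fin d × (ℤ × ℤ) → ℤ × ℤ
  τ (r , hn) = residue d c r hn
  σ : ℤ × ℤ → Fin d × (ℤ × ℤ)
  σ mn = fromℕ< (n%ℕd<d (κ mn) d) , (κ mn /ℕ d , proj₂ mn)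
  restore : ∀ m n c → m + c * n - c * n ≡ m
  restore = solve-∀
  κτ : ∀ k c n → k - c * n + c * n ≡ k
  κτ = solve-∀
  τσ : ∀ mn → τ (σ mn) ≡ mn
  τσ mn@(m , n) = cong (_, n) (≡.trans
    (cong (λ k → k - c * n) (≡.trans
      (cong (λ r → + r + κ mn /ℕ d * + d) (toℕ-fromℕ< (n%ℕd<d (κ mn) d)))
      (≡.sym (a≡a%ℕn+[a/ℕn]*n (κ mn) d))))
    (restore m n c))
  στ : ∀ rhn → σ (τ rhn) ≡ rhn
  στ rhn@(r , (h , n)) = cong₂ (λ r h → r , (h , n)) (toℕ-injective (proj₁ same)) (proj₂ same)
    where
    same : toℕ (proj₁ (σ (τ rhn))) ≡ toℕ r × κ (τ rhn) /ℕ d ≡ h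
    same = divMod-unique _ h (toℕ<n (proj₁ (σ (τ rhn)))) (toℕ<n r) (≡.trans
      (cong (λ r → + r + κ (τ rhn) /ℕ d * + d) (toℕ-fromℕ< (n%ℕd<d (κ (τ rhn)) d)))
      (≡.trans (≡.sym (a≡a%ℕn+[a/ℕn]*n (κ (τ rhn)) d)) (κτ (+ toℕ r + h * + d) c n)))

double-expo₂ : ∀ a b c d m n → + 2 * + (expo a b m ℕ.+ expo c d n) ≡
  (+ a + + b) * (m * m) + (+ a - + b) * m + ((+ c + + d) * (n * n) + (+ c - + d) * n)
double-expo₂ a b c d m n = ≡.trans (ℤₚ.*-distribˡ-+ (+ 2) (+ expo a b m) (+ expo c d n))
  (cong₂ _+_ (double-expo a b m) (double-expo c d n))

double-shift : ∀ k m {x} → + 2 * + m ≡ x → + 2 * + (k ℕ.+ m) ≡ + 2 * + k + x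
double-shift k m p = ≡.trans (ℤₚ.*-distribˡ-+ (+ 2) (+ k) (+ m)) (cong (_+_ (+ 2 * + k)) p)

-- Ramanujan's product formula: for αβ = γδ, f(α, β) f(γ, δ) = f(αγ, βδ) f(αδ, βγ) + α f(β/γ, αγ²δ)
-- f(β/δ, αγδ²). The exponents are parametrised by B = b - c and D = b - d: this builds in a + b = c
-- + d and makes the quotients β/γ and β/δ powers of q with natural exponents.
module _ {s : ℤ → ℤ} (χ : Character s) (a B D : ℕ) (1≤a : 1 ≤ a) where
  open Character χ

  private
    b c d a₂ a₄ : ℕ
    b  = B ℕ.+ D ℕ.+ a
    c  = D ℕ.+ a
    d  = B ℕ.+ a
    a₂ = a ℕ.+ a
    a₄ = a ℕ.+ a ℕ.+ a ℕ.+ a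

    1≤a+a : ∀ k → 1 ≤ a₂ ℕ.+ k
    1≤a+a k = ℕₚ.m≤n⇒m≤n+o k (ℕₚ.m≤n⇒m≤n+o a 1≤a)

    1≤a₄ : ∀ k → 1 ≤ a₄ ℕ.+ k
    1≤a₄ k = ℕₚ.m≤n⇒m≤n+o k (ℕₚ.m≤n⇒m≤n+o a (1≤a+a a))

    parts : Fin 2 → FPS
    parts zero       = Θ triv (a₂ ℕ.+ D) (a₂ ℕ.+ D ℕ.+ B ℕ.+ B) *ₛ Θ triv (a₂ ℕ.+ B) (a₂ ℕ.+ B ℕ.+ D ℕ.+ D)
    parts (suc zero) = (s 1ℤ · mono a) *ₛ (Θ triv (a₄ ℕ.+ (B ℕ.+ D ℕ.+ D)) B *ₛ Θ triv (a₄ ℕ.+ (B ℕ.+ B ℕ.+ D)) D)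

    weight : ℤ × ℤ → ℤ
    weight (m , n) = s m * s n

    exponent : ℤ × ℤ → ℕ
    exponent (m , n) = expo a b m ℕ.+ expo c d n

    involution : ∀ x y → x - (x - y) ≡ y
    involution = solve-∀

    -- The sign of a term depends only on m + n = k + 2h, hence only on the class. This is why the
    -- theta series on the right of `Θ-product` carry the trivial character and the sign survives
    -- only as the factor `s 1ℤ`.
    s-residue : ∀ k h n → s (k + h * + 2 - 1ℤ * n) * s n ≡ s k
    s-residue k h n = begin
      s (k + h * + 2 - 1ℤ * n) * s n      ≡⟨ homo (k + h * + 2 - 1ℤ * n) n ⟨
      s (k + h * + 2 - 1ℤ * n + n)        ≡⟨ cong s (collect k h n) ⟩
      s (k + (h + h))                     ≡⟨ homo k (h + h) ⟩
      s k * s (h + h)                     ≡⟨ cong (s k *_) (≡.trans (homo h h) (square h)) ⟩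
      s k * 1ℤ                            ≡⟨ ℤₚ.*-identityʳ (s k) ⟩
      s k                                 ∎
      where
      open ≡.≡-Reasoning
      collect : ∀ k h n → k + h * + 2 - 1ℤ * n + n ≡ k + (h + h)
      collect = solve-∀

    slices : ∀ r → Sums (weight ∘ residue 2 1ℤ r) (exponent ∘ residue 2 1ℤ r) (parts r)
    slices zero = Sums-reindex (λ (h , n) → h , h - n) (λ (x , y) → x , x - y)
      (λ (x , y) → cong (x ,_) (involution x y)) (λ (h , n) → cong (h ,_) (involution h n))
      (λ (h , n) → ≡.sym (≡.trans (s-residue 0ℤ h n) at-0))
      (λ (h , n) → double-injective (≡.trans (double-expo₂ (a₂ ℕ.+ D) (a₂ ℕ.+ D ℕ.+ B ℕ.+ B) (a₂ ℕ.+ B) (a₂ ℕ.+ B ℕ.+ D ℕ.+ D) h (h - n))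
        (≡.trans (poly (+ a) (+ B) (+ D) h n)
          (≡.sym (double-expo₂ a b c d (proj₁ (residue 2 1ℤ zero (h , n))) n)))))
      (Sums-× (Sums-Θ triv (a₂ ℕ.+ D) (a₂ ℕ.+ D ℕ.+ B ℕ.+ B) (1≤a+a D)) (Sums-Θ triv (a₂ ℕ.+ B) (a₂ ℕ.+ B ℕ.+ D ℕ.+ D) (1≤a+a B)))
      where
      poly : ∀ a B D h n → let m = 0ℤ + h * + 2 - 1ℤ * n in
        (a + a + D + (a + a + D + B + B)) * (h * h) + (a + a + D - (a + a + D + B + B)) * h +
        ((a + a + B + (a + a + B + D + D)) * ((h - n) * (h - n)) + (a + a + B - (a + a + B + D + D)) * (h - n)) ≡
        (a + (B + D + a)) * (m * m) + (a - (B + D + a)) * m +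
        ((D + a + (B + a)) * (n * n) + (D + a - (B + a)) * n)
      poly = solve-∀
    slices (suc zero) = Sums-reindex (λ (h , n) → h , h - n) (λ (x , y) → x , x - y)
      (λ (x , y) → cong (x ,_) (involution x y)) (λ (h , n) → cong (h ,_) (involution h n))
      (λ (h , n) → ≡.sym (≡.trans (s-residue 1ℤ h n) (≡.sym (ℤₚ.*-identityʳ (s 1ℤ)))))
      (λ (h , n) → double-injective (≡.trans (double-shift a (expo (a₄ ℕ.+ (B ℕ.+ D ℕ.+ D)) B h ℕ.+ expo (a₄ ℕ.+ (B ℕ.+ B ℕ.+ D)) D (h - n))
          (double-expo₂ (a₄ ℕ.+ (B ℕ.+ D ℕ.+ D)) B (a₄ ℕ.+ (B ℕ.+ B ℕ.+ D)) D h (h - n)))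
        (≡.trans (poly (+ a) (+ B) (+ D) h n)
          (≡.sym (double-expo₂ a b c d (proj₁ (residue 2 1ℤ (suc zero) (h , n))) n)))))
      (Sums-shift (s 1ℤ) a (Sums-× (Sums-Θ triv (a₄ ℕ.+ (B ℕ.+ D ℕ.+ D)) B (1≤a₄ (B ℕ.+ D ℕ.+ D))) (Sums-Θ triv (a₄ ℕ.+ (B ℕ.+ B ℕ.+ D)) D (1≤a₄ (B ℕ.+ B ℕ.+ D)))))
      where
      poly : ∀ a B D h n → let m = 1ℤ + h * + 2 - 1ℤ * n in
        + 2 * a + ((a + a + a + a + (B + D + D) + B) * (h * h) + (a + a + a + a + (B + D + D) - B) * h +
        ((a + a + a + a + (B + B + D) + D) * ((h - n) * (h - n)) + (a + a + a + a + (B + B + D) - D) * (h - n))) ≡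
        (a + (B + D + a)) * (m * m) + (a - (B + D + a)) * m +
        ((D + a + (B + a)) * (n * n) + (D + a - (B + a)) * n)
      poly = solve-∀

  -- Substitute m = x + y + r and n = x - y, where r is the parity of m + n.
  Θ-product : Θ s a (B ℕ.+ D ℕ.+ a) *ₛ Θ s (D ℕ.+ a) (B ℕ.+ a) ≈
    Θ triv (a₂ ℕ.+ D) (a₂ ℕ.+ D ℕ.+ B ℕ.+ B) *ₛ Θ triv (a₂ ℕ.+ B) (a₂ ℕ.+ B ℕ.+ D ℕ.+ D) +ₛ
    (s 1ℤ · mono a) *ₛ (Θ triv (a₄ ℕ.+ (B ℕ.+ D ℕ.+ D)) B *ₛ Θ triv (a₄ ℕ.+ (B ℕ.+ B ℕ.+ D)) D)
  Θ-product = ≈-trans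
    (Sums-unique (Sums-× (Sums-Θ s a b 1≤a) (Sums-Θ s c d (ℕₚ.m≤n⇒m≤o+n D 1≤a)))
                 (Sums-residues 2 1ℤ slices))
    (+ₛ-congˡ (parts zero) (mk≈ λ n → ℤₚ.+-identityʳ (parts (suc zero) n)))

1≤1+ : ∀ {n} → 1 ≤ suc n
1≤1+ = s≤s z≤n

module GaussianLattice where
  private
    side : FPS
    side = mono 1 *ₛ (Θ triv 9 1 *ₛ Θ triv 7 3)

    parts : Fin 5 → FPS
    parts zero    = Θ triv 5 5 *ₛ Θ triv 5 5
    parts (suc _) = side

    exponent : ℤ × ℤ → ℕ
    exponent (a , b) = expo 1 1 a ℕ.+ expo 1 1 b

    centre-sums : Sums {ℤ × ℤ} (λ _ → 1ℤ) (λ (x , y) → expo 5 5 x ℕ.+ expo 5 5 y) (parts zero)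
    centre-sums = Sums-× (Sums-Θ triv 5 5 1≤1+) (Sums-Θ triv 5 5 1≤1+)

    side-sums : Sums {ℤ × ℤ} (λ _ → 1ℤ) (λ (x , y) → 1 ℕ.+ (expo 9 1 x ℕ.+ expo 7 3 y)) side
    side-sums = Sums-≈ (*ₛ-congʳ (Θ triv 9 1 *ₛ Θ triv 7 3) (mk≈ λ n → ℤₚ.*-identityˡ (mono 1 n)))
      (Sums-shift 1ℤ 1 (Sums-× (Sums-Θ triv 9 1 1≤1+) (Sums-Θ triv 7 3 1≤1+)))

    centre-exponent : ∀ x y a b →
      + 10 * (x * x) + 0ℤ * x + (+ 10 * (y * y) + 0ℤ * y) ≡ + 2 * (a * a) + 0ℤ * a + (+ 2 * (b * b) + 0ℤ * b) →
      expo 5 5 x ℕ.+ expo 5 5 y ≡ exponent (a , b)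
    centre-exponent x y a b p = double-injective
      (≡.trans (double-expo₂ 5 5 5 5 x y) (≡.trans p (≡.sym (double-expo₂ 1 1 1 1 a b))))

    -- Completing squares, the left exponent is ((5x + 2)² + (5y + 1)²) / 5. As (5x + 2) + (5y + 1)
    -- i = (2 + i)(1 + (2 - i)(x + y i)), this is the norm of 1 + (2 - i)(x + y i), which explains
    -- the pairs (9, 1) and (7, 3).
    side-exponent : ∀ x y a b →
      + 2 + (+ 10 * (x * x) + + 8 * x + (+ 10 * (y * y) + + 4 * y)) ≡ + 2 * (a * a) + 0ℤ * a + (+ 2 * (b * b) + 0ℤ * b) →
      1 ℕ.+ (expo 9 1 x ℕ.+ expo 7 3 y) ≡ exponent (a , b)
    side-exponent x y a b p = double-injective
      (≡.trans (double-shift 1 (expo 9 1 x ℕ.+ expo 7 3 y) (double-expo₂ 9 1 7 3 x y))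
        (≡.trans p (≡.sym (double-expo₂ 1 1 1 1 a b))))

    -- For r = 0 the substitution solves a + b i = (2 - i)(x + y i) for x and y. For r = 1, 2, 3, 4
    -- it solves a + b i = u (1 + (2 - i)(x + y i)) with u = 1, i, -i, -1, the units at which a + 2
    -- b is 1, 2, -2, -1.
    slices : ∀ r → Sums {ℤ × ℤ} (λ _ → 1ℤ) (exponent ∘ residue 5 (+ 2) r) (parts r)
    slices zero = Sums-reindex
      (λ (h , b) → + 2 * h - b , h) (λ (x , y) → y , + 2 * y - x)
      (λ (x , y) → cong (_, y) (inv x y)) (λ (h , b) → cong (h ,_) (inv b h)) (λ _ → ≡.refl)
      (λ (h , b) → centre-exponent (+ 2 * h - b) h (+ 0 + h * + 5 - + 2 * b) b (poly h b)) centre-sums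
      where
      inv : ∀ x y → + 2 * y - (+ 2 * y - x) ≡ x
      inv = solve-∀
      poly : ∀ h b → let x = + 2 * h - b ; a = 0ℤ + h * + 5 - + 2 * b in
        + 10 * (x * x) + 0ℤ * x + (+ 10 * (h * h) + 0ℤ * h) ≡ + 2 * (a * a) + 0ℤ * a + (+ 2 * (b * b) + 0ℤ * b)
      poly = solve-∀
    slices (suc zero) = Sums-reindex
      (λ (h , b) → + 2 * h - b , h) (λ (x , y) → y , + 2 * y - x)
      (λ (x , y) → cong (_, y) (inv x y)) (λ (h , b) → cong (h ,_) (inv b h)) (λ _ → ≡.refl)
      (λ (h , b) → side-exponent (+ 2 * h - b) h (+ 1 + h * + 5 - + 2 * b) b (poly h b)) side-sums
      where
      inv : ∀ x y → + 2 * y - (+ 2 * y - x) ≡ x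
      inv = solve-∀
      poly : ∀ h b → let x = + 2 * h - b ; a = + 1 + h * + 5 - + 2 * b in
        + 2 + (+ 10 * (x * x) + + 8 * x + (+ 10 * (h * h) + + 4 * h)) ≡ + 2 * (a * a) + 0ℤ * a + (+ 2 * (b * b) + 0ℤ * b)
      poly = solve-∀
    slices (suc (suc zero)) = Sums-reindex
      (λ (h , b) → h , b - + 2 * h - + 1) (λ (x , y) → x , + 2 * x + y + + 1)
      (λ (x , y) → cong (x ,_) (inv₁ x y)) (λ (h , b) → cong (h ,_) (inv₂ h b)) (λ _ → ≡.refl)
      (λ (h , b) → side-exponent h (b - + 2 * h - + 1) (+ 2 + h * + 5 - + 2 * b) b (poly h b)) side-sums
      where
      inv₁ : ∀ x y → + 2 * x + y + + 1 - + 2 * x - + 1 ≡ y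
      inv₁ = solve-∀
      inv₂ : ∀ h b → + 2 * h + (b - + 2 * h - + 1) + + 1 ≡ b
      inv₂ = solve-∀
      poly : ∀ h b → let y = b - + 2 * h - + 1 ; a = + 2 + h * + 5 - + 2 * b in
        + 2 + (+ 10 * (h * h) + + 8 * h + (+ 10 * (y * y) + + 4 * y)) ≡ + 2 * (a * a) + 0ℤ * a + (+ 2 * (b * b) + 0ℤ * b)
      poly = solve-∀
    slices (suc (suc (suc zero))) = Sums-reindex
      (λ (h , b) → - h - + 1 , + 2 * h + + 1 - b) (λ (x , y) → - x - + 1 , - (+ 2 * x + y + + 1))
      (λ (x , y) → cong₂ _,_ (inv₀ x) (inv₁ x y)) (λ (h , b) → cong₂ _,_ (inv₀ h) (inv₂ h b)) (λ _ → ≡.refl)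
      (λ (h , b) → side-exponent (- h - + 1) (+ 2 * h + + 1 - b) (+ 3 + h * + 5 - + 2 * b) b (poly h b)) side-sums
      where
      inv₀ : ∀ x → - (- x - + 1) - + 1 ≡ x
      inv₀ = solve-∀
      inv₁ : ∀ x y → + 2 * (- x - + 1) + + 1 - - (+ 2 * x + y + + 1) ≡ y
      inv₁ = solve-∀
      inv₂ : ∀ h b → - (+ 2 * (- h - + 1) + (+ 2 * h + + 1 - b) + + 1) ≡ b
      inv₂ = solve-∀
      poly : ∀ h b → let x = - h - + 1 ; y = + 2 * h + + 1 - b ; a = + 3 + h * + 5 - + 2 * b in
        + 2 + (+ 10 * (x * x) + + 8 * x + (+ 10 * (y * y) + + 4 * y)) ≡ + 2 * (a * a) + 0ℤ * a + (+ 2 * (b * b) + 0ℤ * b)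
      poly = solve-∀
    slices (suc (suc (suc (suc zero)))) = Sums-reindex
      (λ (h , b) → b - + 2 * h - + 2 , - h - + 1) (λ (x , y) → - y - + 1 , x - + 2 * y)
      (λ (x , y) → cong₂ _,_ (inv₁ x y) (inv₀ y)) (λ (h , b) → cong₂ _,_ (inv₀ h) (inv₂ h b)) (λ _ → ≡.refl)
      (λ (h , b) → side-exponent (b - + 2 * h - + 2) (- h - + 1) (+ 4 + h * + 5 - + 2 * b) b (poly h b)) side-sums
      where
      inv₀ : ∀ x → - (- x - + 1) - + 1 ≡ x
      inv₀ = solve-∀
      inv₁ : ∀ x y → x - + 2 * y - + 2 * (- y - + 1) - + 2 ≡ x
      inv₁ = solve-∀
      inv₂ : ∀ h b → b - + 2 * h - + 2 - + 2 * (- h - + 1) ≡ b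
      inv₂ = solve-∀
      poly : ∀ h b → let x = b - + 2 * h - + 2 ; y = - h - + 1 ; a = + 4 + h * + 5 - + 2 * b in
        + 2 + (+ 10 * (x * x) + + 8 * x + (+ 10 * (y * y) + + 4 * y)) ≡ + 2 * (a * a) + 0ℤ * a + (+ 2 * (b * b) + 0ℤ * b)
      poly = solve-∀

  -- In ℤ[i], the points a + b i with a + 2 b ≡ 0 (mod 5) are the multiples of 2 - i, which give φ(q⁵)²;
  -- the other four residue classes of a + 2 b are the translates of these by the units.
  φ-squares : Θ triv 1 1 *ₛ Θ triv 1 1 ≈
              Θ triv 5 5 *ₛ Θ triv 5 5 +ₛ + 4 · (mono 1 *ₛ (Θ triv 9 1 *ₛ Θ triv 7 3))
  φ-squares = ≈-trans
    (Sums-unique (Sums-× (Sums-Θ triv 1 1 1≤1+) (Sums-Θ triv 1 1 1≤1+)) (Sums-residues 5 (+ 2) slices))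
    (mk≈ λ n → cong (_+_ (parts zero n)) (four (side n)))
    where
    four : ∀ x → x + (x + (x + (x + 0ℤ))) ≡ + 4 * x
    four = solve-∀

open GaussianLattice using (φ-squares)

-- The Jacobi triple product

·-mono-≈[]-0 : ∀ c {k N} → N < k → c · mono k ≈[ N ] zeroₛ
·-mono-≈[]-0 c N<k n n≤N = ≡.trans (cong (c *_) (mono-≈[]-0 N<k n n≤N)) (ℤₚ.*-zeroʳ c)

*ₛ-≈[]-0 : ∀ {N} f {g} → g ≈[ N ] zeroₛ → f *ₛ g ≈[ N ] zeroₛ
*ₛ-≈[]-0 f {g} p = ≈[]-trans {g = f *ₛ zeroₛ} (*ₛ-cong[] {f = f} {g = g} ≈[]-refl p) (≈⇒≈[] (*ₛ-zeroʳ f))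

poch⁺-≈[] : ∀ c {a m N} → N < a → poch⁺ c a m ≈[ N ] oneₛ
poch⁺-≈[] c {a} {m} {N} N<a n n≤N = go n n n≤N
  where
  factor : ∀ i → onePlus c (a ℕ.+ m ℕ.* i) ≈[ N ] oneₛ
  factor i = onePlus-≈[] c (ℕₚ.≤-trans N<a (ℕₚ.m≤m+n a (m ℕ.* i)))
  go : ∀ k → prodTo k (λ i → onePlus c (a ℕ.+ m ℕ.* i)) ≈[ N ] oneₛ
  go zero    = factor 0
  go (suc k) = ≈[]-trans {g = oneₛ *ₛ oneₛ}
    (*ₛ-cong[] {f = prodTo k _} {g = onePlus c (a ℕ.+ m ℕ.* suc k)} (go k) (factor (suc k)))
    (≈⇒≈[] (*ₛ-identityˡ oneₛ))

Lim-mono-*ₛ : ∀ (k : ℕ → ℕ) → (∀ n → n ≤ k n) → ∀ (g : ℕ → FPS) → Lim (λ n → mono (k n) *ₛ g n) zeroₛ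
Lim-mono-*ₛ k n≤kn g N = suc N , λ n N<n → ≈[]-trans {g = zeroₛ *ₛ g n}
  (*ₛ-cong[] {f = mono (k n)} {g = g n} (mono-≈[]-0 (ℕₚ.≤-trans N<n (n≤kn n))) ≈[]-refl)
  (≈⇒≈[] (zeroₛ-*ₛ (g n)))

∑< : ℕ → (ℕ → FPS) → FPS
∑< n F = ∑ₛ (downFrom n) F

∑<-Lim : ∀ F → (∀ {N} j → N < j → F j ≈[ N ] zeroₛ) → Lim (λ n → ∑< n F) (λ N → ∑< (suc N) F N)
∑<-Lim F small N = suc N , λ n N<n k k≤N → go n k (ℕₚ.≤-<-trans k≤N N<n)
  where
  go : ∀ n k → k < n → ∑< n F k ≡ ∑< (suc k) F k
  go (suc n) k (s≤s k≤n) with ℕₚ.m≤n⇒m<n∨m≡n k≤n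
  ... | inj₂ ≡.refl = ≡.refl
  ... | inj₁ k<n    = ≡.trans (cong₂ _+_ (small n k<n k ℕₚ.≤-refl) (go n k k<n)) (ℤₚ.+-identityˡ _)

-- With Q = q^m, z = εq^a, w k the k-th term of the theta series and P j = (Q^(j+1) ; Q)_∞, raising p by one
-- multiplies ∑_{j≥0} P j w(p - j) by 1 + z Q^p.  For p = 0 this sum is Euler's series, and as p → ∞ it
-- tends to the theta series.
module JacobiTripleProduct {s : ℤ → ℤ} (χ : Character s) (a b : ℕ) (1≤a : 1 ≤ a) (1≤b : 1 ≤ b) where
  open Character χ

  m : ℕ
  m = a ℕ.+ b

  1≤m : 1 ≤ m
  1≤m = ℕₚ.m≤n⇒m≤n+o b 1≤a

  n≤mn : ∀ n → n ≤ m ℕ.* n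
  n≤mn n = ℕₚ.≤-trans (ℕₚ.≤-reflexive (≡.sym (ℕₚ.*-identityˡ n))) (ℕₚ.*-monoˡ-≤ n 1≤m)

  ε : ℤ
  ε = s 1ℤ

  -- (q^(m (j + 1)) ; q^m)_∞
  P : ℕ → FPS
  P j = poch⁺ -1ℤ (m ℕ.+ m ℕ.* j) m

  P-step : ∀ j → P j ≈ (oneₛ +ₛ negₛ (mono (m ℕ.* suc j))) *ₛ P (suc j)
  P-step j = ≈-trans (poch⁺-step -1ℤ (m ℕ.+ m ℕ.* j) m (ℕₚ.m≤n⇒m≤n+o (m ℕ.* j) 1≤m) 1≤m) (*ₛ-cong
    (mk≈ λ n → cong (_+_ (oneₛ n)) (≡.trans (ℤₚ.-1*i≡-i _) (cong (λ k → - mono k n) (≡.sym (ℕₚ.*-suc m j)))))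
    (≡⇒≈ (cong (λ k → poch⁺ -1ℤ k m) (≡.trans (ℕₚ.+-comm (m ℕ.+ m ℕ.* j) m) (cong (m ℕ.+_) (≡.sym (ℕₚ.*-suc m j)))))))

  T : (ℕ → FPS) → ℕ → FPS
  T u n = ∑< n (λ j → P j *ₛ u j)

  module _ (c : FPS) (u u′ : ℕ → FPS) (rec : ∀ j → c *ₛ u j ≈ u′ (suc j) +ₛ mono (m ℕ.* j) *ₛ u′ j) where

    -- By `P-step`, P j u′(j + 1) = P (j + 1) u′(j + 1) - Q^(j+1) P (j + 1) u′(j + 1). The
    -- subtracted terms telescope against the terms Q^j P j u′ j from `rec`, leaving one boundary
    -- term, which tends to 0. The same `rec` governs both Euler's series and the shifted theta
    -- sums.
    T-step : ∀ n → T u′ (suc n) ≈ c *ₛ T u n +ₛ mono (m ℕ.* n) *ₛ (P n *ₛ u′ n)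
    T-step zero = ≈-sym (≈-trans
      (+ₛ-cong (*ₛ-zeroʳ c) (≈-trans (*ₛ-congʳ (P 0 *ₛ u′ 0) (≡⇒≈ (cong mono (ℕₚ.*-zeroʳ m)))) (*ₛ-identityˡ (P 0 *ₛ u′ 0))))
      (+ₛ-comm zeroₛ (P 0 *ₛ u′ 0)))
    T-step (suc n) = ≈-trans (+ₛ-congˡ (P₁ *ₛ v₁) (T-step n)) (≈-sym (begin
      c *ₛ (P₀ *ₛ u n +ₛ X) +ₛ M₁ *ₛ (P₁ *ₛ v₁)
        ≈⟨ solve 7 (λ c P u X M P′ v → c :* (P :* u :+ X) :+ M :* (P′ :* v) := P :* (c :* u) :+ c :* X :+ M :* (P′ :* v))
             ≈-refl c P₀ (u n) X M₁ P₁ v₁ ⟩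
      P₀ *ₛ (c *ₛ u n) +ₛ c *ₛ X +ₛ M₁ *ₛ (P₁ *ₛ v₁)
        ≈⟨ +ₛ-congʳ (M₁ *ₛ (P₁ *ₛ v₁)) (+ₛ-congʳ (c *ₛ X) (*ₛ-congˡ P₀ (rec n))) ⟩
      P₀ *ₛ (v₁ +ₛ M₀ *ₛ v₀) +ₛ c *ₛ X +ₛ M₁ *ₛ (P₁ *ₛ v₁)
        ≈⟨ solve 7 (λ P v₁ M₀ v₀ X M₁ P₁ → P :* (v₁ :+ M₀ :* v₀) :+ X :+ M₁ :* (P₁ :* v₁) :=
                      P :* v₁ :+ (X :+ M₀ :* (P :* v₀) :+ M₁ :* (P₁ :* v₁)))
             ≈-refl P₀ v₁ M₀ v₀ (c *ₛ X) M₁ P₁ ⟩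
      P₀ *ₛ v₁ +ₛ (Y +ₛ M₁ *ₛ (P₁ *ₛ v₁))
        ≈⟨ +ₛ-congʳ (Y +ₛ M₁ *ₛ (P₁ *ₛ v₁)) (*ₛ-congʳ v₁ (P-step n)) ⟩
      (oneₛ +ₛ negₛ M₁) *ₛ P₁ *ₛ v₁ +ₛ (Y +ₛ M₁ *ₛ (P₁ *ₛ v₁))
        ≈⟨ solve 5 (λ i M P v Y → (i :+ :- M) :* P :* v :+ (Y :+ M :* (P :* v)) := i :* (P :* v) :+ Y)
             ≈-refl oneₛ M₁ P₁ v₁ Y ⟩
      oneₛ *ₛ (P₁ *ₛ v₁) +ₛ Y
        ≈⟨ +ₛ-congʳ Y (*ₛ-identityˡ (P₁ *ₛ v₁)) ⟩
      P₁ *ₛ v₁ +ₛ Y ∎))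
      where
      open Solver
      open import Relation.Binary.Reasoning.Setoid setoid
      P₀ P₁ M₀ M₁ v₀ v₁ X Y : FPS
      P₀ = P n
      P₁ = P (suc n)
      M₀ = mono (m ℕ.* n)
      M₁ = mono (m ℕ.* suc n)
      v₀ = u′ n
      v₁ = u′ (suc n)
      X  = T u n
      Y  = c *ₛ X +ₛ M₀ *ₛ (P₀ *ₛ v₀)

    T-Lim : ∀ {X} → Lim (T u) X → Lim (T u′) (c *ₛ X)
    T-Lim {X} l = Lim-unshift (Lim-cong (λ n → ≈-sym (T-step n)) (mk≈ λ n → ℤₚ.+-identityʳ ((c *ₛ X) n))
      (Lim-+ₛ (Lim-*ₛ (Lim-const c) l) (Lim-mono-*ₛ (m ℕ.*_) n≤mn (λ n → P n *ₛ u′ n))))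

  onePlus-*ₛ-· : ∀ k c l → onePlus ε k *ₛ (c · mono l) ≈ c · mono l +ₛ (ε * c) · mono (k ℕ.+ l)
  onePlus-*ₛ-· k c l = ≈-trans (*ₛ-distribʳ (c · mono l) oneₛ (ε · mono k)) (+ₛ-cong (*ₛ-identityˡ (c · mono l))
    (≈-trans (·-*ₛ-· ε c (mono k) (mono l)) (·-cong {ε * c} ≡.refl (mono-*ₛ-mono k l))))

  mono-*ₛ-· : ∀ k c l → mono k *ₛ (c · mono l) ≈ c · mono (k ℕ.+ l)
  mono-*ₛ-· k c l = ≈-trans (*ₛ-comm (mono k) (c · mono l)) (≈-trans (·-*ₛ c (mono l) (mono k))
    (·-cong {c} ≡.refl (≈-trans (*ₛ-comm (mono l) (mono k)) (mono-*ₛ-mono k l))))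

  -- Euler's expansion of (-z ; Q)_∞ has denominators (Q ; Q)_j. Multiplication by (Q ; Q)_∞ turns
  -- their inverses into the factors `P j`, so no division occurs. The exponent `β` stays free
  -- because `E-step` moves it.
  v : ℕ → ℕ → FPS
  v β j = s (+ j) · mono (m ℕ.* triℕ j ℕ.+ β ℕ.* j)

  -- Euler's series for (-εq^β ; q^m)_∞ (q^m ; q^m)_∞.
  E : ℕ → FPS
  E β N = T (v β) (suc N) N

  v-small : ∀ {β} → 1 ≤ β → ∀ {N} j → N < j → P j *ₛ v β j ≈[ N ] zeroₛ
  v-small {β} 1≤β j N<j = *ₛ-≈[]-0 (P j) (·-mono-≈[]-0 (s (+ j)) (ℕₚ.≤-trans N<j (begin
    j                              ≡⟨ ℕₚ.*-identityˡ j ⟨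
    1 ℕ.* j                        ≤⟨ ℕₚ.*-monoˡ-≤ j 1≤β ⟩
    β ℕ.* j                        ≤⟨ ℕₚ.m≤n+m (β ℕ.* j) (m ℕ.* triℕ j) ⟩
    m ℕ.* triℕ j ℕ.+ β ℕ.* j       ∎)))
    where open ℕₚ.≤-Reasoning

  E-Lim : ∀ {β} → 1 ≤ β → Lim (T (v β)) (E β)
  E-Lim {β} 1≤β = ∑<-Lim (λ j → P j *ₛ v β j) (v-small 1≤β)

  -- Euler's functional equation E(z) = (1 + z) E(zQ). Iterating it sends `β` to infinity, where
  -- only the term j = 0 survives, with value `P 0`.
  E-step : ∀ {β} → 1 ≤ β → E β ≈ onePlus ε β *ₛ E (β ℕ.+ m)
  E-step {β} 1≤β = Lim-unique (E-Lim 1≤β)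
    (T-Lim (onePlus ε β) (v (β ℕ.+ m)) (v β) rec (E-Lim (ℕₚ.m≤n⇒m≤n+o m 1≤β)))
    where
    open +-*-Solver
    rec : ∀ j → onePlus ε β *ₛ v (β ℕ.+ m) j ≈ v β (suc j) +ₛ mono (m ℕ.* j) *ₛ v β j
    rec j = ≈-trans (onePlus-*ₛ-· β (s (+ j)) (m ℕ.* triℕ j ℕ.+ (β ℕ.+ m) ℕ.* j))
      (≈-trans (+ₛ-comm (v (β ℕ.+ m) j) ((ε * s (+ j)) · mono (β ℕ.+ (m ℕ.* triℕ j ℕ.+ (β ℕ.+ m) ℕ.* j)))) (+ₛ-cong
        (≡⇒≈ (cong₂ (λ c k → c · mono k) (≡.sym (homo 1ℤ (+ j)))
          (solve 4 (λ β m t j → β :+ (m :* t :+ (β :+ m) :* j) := m :* (j :+ t) :+ β :* (con 1 :+ j)) ≡.refl β m (triℕ j) j)))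
        (≈-trans (≡⇒≈ (cong (λ k → s (+ j) · mono k)
          (solve 4 (λ β m t j → m :* t :+ (β :+ m) :* j := m :* j :+ (m :* t :+ β :* j)) ≡.refl β m (triℕ j) j)))
          (≈-sym (mono-*ₛ-· (m ℕ.* j) (s (+ j)) (m ℕ.* triℕ j ℕ.+ β ℕ.* j))))))

  E-product : ∀ n → E b ≈ ∏< n (λ i → onePlus ε (b ℕ.+ m ℕ.* i)) *ₛ E (b ℕ.+ m ℕ.* n)
  E-product zero    = ≈-sym (≈-trans (*ₛ-identityˡ (E (b ℕ.+ m ℕ.* 0)))
    (≡⇒≈ (cong E (≡.trans (cong (b ℕ.+_) (ℕₚ.*-zeroʳ m)) (ℕₚ.+-identityʳ b)))))
  E-product (suc n) = ≈-trans (E-product n) (≈-trans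
    (*ₛ-congˡ Π (≈-trans (E-step (ℕₚ.m≤n⇒m≤n+o (m ℕ.* n) 1≤b))
      (*ₛ-congˡ (onePlus ε (b ℕ.+ m ℕ.* n)) (≡⇒≈ (cong E
        (≡.trans (ℕₚ.+-assoc b (m ℕ.* n) m) (cong (b ℕ.+_) (≡.trans (ℕₚ.+-comm (m ℕ.* n) m) (≡.sym (ℕₚ.*-suc m n))))))))))
    (≈-sym (*ₛ-assoc Π (onePlus ε (b ℕ.+ m ℕ.* n)) (E (b ℕ.+ m ℕ.* suc n)))))
    where
    Π : FPS
    Π = ∏< n (λ i → onePlus ε (b ℕ.+ m ℕ.* i))

  E-≈[] : ∀ {β N} → N < β → E β ≈[ N ] P 0
  E-≈[] {β} {N} N<β n n≤N = go n n n≤N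
    where
    head : P 0 *ₛ v β 0 ≈ P 0
    head = ≈-trans (*ₛ-congˡ (P 0) (≈-trans
      (≡⇒≈ (cong₂ (λ c k → c · mono k) at-0 (cong₂ ℕ._+_ (ℕₚ.*-zeroʳ m) (ℕₚ.*-zeroʳ β))))
      (mk≈ λ n → ℤₚ.*-identityˡ (oneₛ n)))) (*ₛ-identityʳ (P 0))
    small : ∀ j → P (suc j) *ₛ v β (suc j) ≈[ N ] zeroₛ
    small j = *ₛ-≈[]-0 (P (suc j)) (·-mono-≈[]-0 (s (+ suc j)) (ℕₚ.≤-trans N<β
      (ℕₚ.≤-trans (ℕₚ.m≤m*n β (suc j)) (ℕₚ.m≤n+m (β ℕ.* suc j) (m ℕ.* triℕ (suc j))))))
    go : ∀ k → T (v β) (suc k) ≈[ N ] P 0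
    go zero    n n≤N = ≡.trans (ℤₚ.+-identityʳ _) (at head n)
    go (suc k) n n≤N = ≡.trans (cong₂ _+_ (small k n n≤N) (go k n n≤N)) (ℤₚ.+-identityˡ _)

  E≈poch⁺ : E b ≈ poch⁺ ε b m *ₛ P 0
  E≈poch⁺ = Lim-unique (Lim-cong E-product ≈-refl (Lim-const (E b)))
    (Lim-*ₛ (∏∞-Lim (onePlus-tame ε {b} {m} 1≤b 1≤m))
      (λ N → N , λ n N≤n → E-≈[] (ℕₚ.≤-<-trans N≤n (n<a+mn 1≤b 1≤m n))))

  w : ℤ → FPS
  w = term s (expo a b)

  shifted : ℕ → ℕ → FPS
  shifted p j = w (+ p - + j)

  -- Consecutive theta terms satisfy w(k + 1) = z Q^k w(k). At k = p - j this gives z Q^p w(p - j) =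
  -- Q^j w(p + 1 - j).
  shifted-rec : ∀ p j → onePlus ε (a ℕ.+ m ℕ.* p) *ₛ shifted p j ≈
                        shifted (suc p) (suc j) +ₛ mono (m ℕ.* j) *ₛ shifted (suc p) j
  shifted-rec p j = ≈-trans (onePlus-*ₛ-· (a ℕ.+ m ℕ.* p) (s k) (expo a b k)) (+ₛ-cong
    (≡⇒≈ (cong w (down (+ p) (+ j))))
    (≈-trans (≡⇒≈ (cong₂ (λ c l → c · mono l)
        (≡.trans (≡.sym (homo 1ℤ k)) (cong s (≡.sym (ℤₚ.+-assoc 1ℤ (+ p) (- + j))))) exponents))
      (≈-sym (mono-*ₛ-· (m ℕ.* j) (s (+ suc p - + j)) (expo a b (+ suc p - + j))))))
    where
    k : ℤ
    k = + p - + j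
    quadratic : ℤ → ℤ
    quadratic k = (+ a + + b) * (k * k) + (+ a - + b) * k
    down : ∀ p j → p - j ≡ 1ℤ + p - (1ℤ + j)
    down = solve-∀
    poly : ∀ a b p j → let k = p - j ; k′ = 1ℤ + p - j in
      + 2 * (a + (a + b) * p) + ((a + b) * (k * k) + (a - b) * k) ≡
      + 2 * ((a + b) * j) + ((a + b) * (k′ * k′) + (a - b) * k′)
    poly = solve-∀
    exponents : a ℕ.+ m ℕ.* p ℕ.+ expo a b k ≡ m ℕ.* j ℕ.+ expo a b (+ suc p - + j)
    exponents = double-injective (≡.trans (double-shift (a ℕ.+ m ℕ.* p) (expo a b k) (double-expo a b k))
      (≡.trans (cong (λ x → + 2 * (+ a + x) + quadratic k) (ℤₚ.pos-* m p))
      (≡.trans (poly (+ a) (+ b) (+ p) (+ j))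
      (≡.sym (≡.trans (double-shift (m ℕ.* j) (expo a b (+ suc p - + j)) (double-expo a b (+ suc p - + j)))
        (cong (λ x → + 2 * x + quadratic (+ suc p - + j)) (ℤₚ.pos-* m j)))))))

  shifted-0 : ∀ j → v b j ≈ shifted 0 j
  shifted-0 j = ≡⇒≈ (≡.sym (≡.trans (cong w (ℤₚ.+-identityˡ (- + j)))
    (cong₂ (λ c k → c · mono k) (at-neg (+ j)) exponents)))
    where
    poly : ∀ a b j → (a + b) * (- j * - j) + (a - b) * - j ≡ (a + b) * (j * (j - 1ℤ)) + + 2 * (b * j)
    poly = solve-∀
    push : ∀ m t x → m * (+ 2 * t) + + 2 * x ≡ + 2 * (m * t + x)
    push = solve-∀
    exponents : expo a b (- + j) ≡ m ℕ.* triℕ j ℕ.+ b ℕ.* j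
    exponents = double-injective (≡.trans (double-expo a b (- + j)) (≡.trans (poly (+ a) (+ b) (+ j))
      (≡.trans (cong (λ x → + m * x + + 2 * (+ b * + j)) (≡.sym (double-triℕ j)))
      (≡.trans (push (+ m) (+ triℕ j) (+ b * + j))
        (cong₂ (λ x y → + 2 * (x + y)) (≡.sym (ℤₚ.pos-* m (triℕ j))) (≡.sym (ℤₚ.pos-* b j)))))))

  X : ℕ → FPS
  X p = ∏< p (λ i → onePlus ε (a ℕ.+ m ℕ.* i)) *ₛ E b

  shifted-Lim : ∀ p → Lim (T (shifted p)) (X p)
  shifted-Lim zero    = Lim-cong (λ n → ∑ₛ-cong (downFrom n) λ j → *ₛ-congˡ (P j) (shifted-0 j))
    (≈-sym (*ₛ-identityˡ (E b))) (E-Lim 1≤b)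
  shifted-Lim (suc p) = Lim-cong (λ n → ≈-refl)
    (solve 3 (λ c π e → c :* (π :* e) := π :* c :* e) ≈-refl
      (onePlus ε (a ℕ.+ m ℕ.* p)) (∏< p (λ i → onePlus ε (a ℕ.+ m ℕ.* i))) (E b))
    (T-Lim (onePlus ε (a ℕ.+ m ℕ.* p)) (shifted p) (shifted (suc p)) (shifted-rec p) (shifted-Lim p))
    where open Solver

  -- For large j the factor `P j` is close to 1; for small j the exponent e of w(p - j) is large.
  -- Quantitatively, `P j` agrees with 1 up to order j, multiplication by q^e raises this to e + j,
  -- and p ≤ |p - j| + j ≤ 1 + e + j.
  P-*ₛ-shifted : ∀ {N p} → N < p → ∀ j → P j *ₛ shifted p j ≈[ N ] shifted p j
  P-*ₛ-shifted {N} {p} N<p j = ≈[]-trans {g = s k · (mono e *ₛ P j)}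
    (≈⇒≈[] (≈-trans (*ₛ-comm (P j) (s k · mono e)) (·-*ₛ (s k) (mono e) (P j))))
    (λ n n≤N → cong (s k *_) (≡.trans (mono-*ₛ-cong[] e P≈1 n (ℕₚ.≤-trans n≤N N≤e+j)) (at (*ₛ-identityʳ (mono e)) n)))
    where
    k : ℤ
    k = + p - + j
    e : ℕ
    e = expo a b k
    P≈1 : P j ≈[ j ] oneₛ
    P≈1 = poch⁺-≈[] -1ℤ {m = m} (n<a+mn 1≤m 1≤m j)
    restore : ∀ p j → p - j + j ≡ p
    restore = solve-∀
    N≤e+j : N ≤ e ℕ.+ j
    N≤e+j = ℕₚ.≤-pred (begin
      suc N                ≤⟨ N<p ⟩
      ∣ + p ∣              ≡⟨ cong ∣_∣ (restore (+ p) (+ j)) ⟨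
      ∣ k + + j ∣          ≤⟨ ℤₚ.∣i+j∣≤∣i∣+∣j∣ k (+ j) ⟩
      ∣ k ∣ ℕ.+ j          ≤⟨ ℕₚ.+-monoˡ-≤ j (∣n∣≤1+expo b 1≤a k) ⟩
      suc (e ℕ.+ j)        ∎)
      where open ℕₚ.≤-Reasoning

  -- An index k of exponent at most N has |k| ≤ N + 1 ≤ p, so k = p - j with 0 ≤ j ≤ N + 1 + p < n.
  shifted-covers : ∀ {N p n} → N < p → suc N ℕ.+ p < n → Covers (expo a b) N (map (λ j → + p - + j) (downFrom n))
  shifted-covers {N} {p} {n} N<p bound = covers (Unique.map⁺ injective (Unique.downFrom⁺ n)) exhaustive
    where
    reflect : ∀ p k → p - (p - k) ≡ k
    reflect = solve-∀
    injective : ∀ {i j} → + p - + i ≡ + p - + j → i ≡ j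
    injective {i} {j} eq = ℤₚ.+-injective (≡.trans (≡.sym (reflect (+ p) (+ i)))
      (≡.trans (cong (_-_ (+ p)) eq) (reflect (+ p) (+ j))))
    exhaustive : ∀ k → expo a b k ≤ N → k ∈ map (λ j → + p - + j) (downFrom n)
    exhaustive k e≤N = subst (_∈ map (λ j → + p - + j) (downFrom n))
      (≡.trans (cong (_-_ (+ p)) (ℤₚ.0≤i⇒+∣i∣≡i nonneg)) (reflect (+ p) k))
      (∈-map⁺ (λ j → + p - + j) (∈-downFrom⁺ small))
      where
      i≤+∣i∣ : ∀ i → i ℤ.≤ + ∣ i ∣
      i≤+∣i∣ (+ n)    = ℤₚ.≤-refl
      i≤+∣i∣ -[1+ n ] = ℤ.-≤+
      ∣k∣≤ : ∣ k ∣ ≤ suc N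
      ∣k∣≤ = ℕₚ.≤-trans (∣n∣≤1+expo b 1≤a k) (s≤s e≤N)
      nonneg : 0ℤ ℤ.≤ + p - k
      nonneg = ℤₚ.i≤j⇒0≤j-i (ℤₚ.≤-trans (i≤+∣i∣ k) (ℤ.+≤+ (ℕₚ.≤-trans ∣k∣≤ N<p)))
      small : ∣ + p - k ∣ < n
      small = ℕₚ.≤-<-trans (ℕₚ.≤-trans (ℤₚ.∣i-j∣≤∣i∣+∣j∣ (+ p) k)
        (ℕₚ.≤-trans (ℕₚ.≤-reflexive (ℕₚ.+-comm p ∣ k ∣)) (ℕₚ.+-monoˡ-≤ p ∣k∣≤))) bound

  X-Lim : Lim X (Θ s a b)
  X-Lim N = suc N , λ p N<p → let (K , close) = shifted-Lim p N
                                  -- The truncation must lie beyond `K`, to agree with `X p` up to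
                                  -- order N, and be long enough for `shifted-covers`.
                                  n = K ⊔ suc (suc N ℕ.+ p) in
    ≈[]-trans (≈[]-sym (close n (ℕₚ.m≤m⊔n K _)))
      (≈[]-trans {g = ∑< n (shifted p)} (∑ₛ-cong[] (downFrom n) (P-*ₛ-shifted N<p))
      (≈[]-trans {g = ∑ₛ (map (λ j → + p - + j) (downFrom n)) w} (≈⇒≈[] (≈-sym (∑ₛ-map (λ j → + p - + j) (downFrom n) w)))
        (Sums-eval (Sums-Θ s a b 1≤a) (shifted-covers N<p (ℕₚ.m≤n⊔m K _)))))

  jacobi : Θ s a b ≈ poch⁺ ε a m *ₛ (poch⁺ ε b m *ₛ P 0)
  jacobi = Lim-unique X-Lim (Lim-*ₛ (∏∞-Lim (onePlus-tame ε {a} {m} 1≤a 1≤m)) (Lim-cong (λ _ → ≈-refl {E b}) E≈poch⁺ (Lim-const (E b))))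

-- Conjugate products and series of squares

poch⁺-conj : ∀ a m → 1 ≤ a → 1 ≤ m → poch⁺ 1ℤ a m *ₛ poch⁺ -1ℤ a m ≈ poch⁺ -1ℤ (a ℕ.+ a) (m ℕ.+ m)
poch⁺-conj a m 1≤a 1≤m = ≈-trans
  (∏∞-*ₛ (onePlus-tame 1ℤ {a} {m} 1≤a 1≤m) (onePlus-tame -1ℤ {a} {m} 1≤a 1≤m))
  (∏∞-cong {λ i → onePlus 1ℤ (a ℕ.+ m ℕ.* i) *ₛ onePlus -1ℤ (a ℕ.+ m ℕ.* i)} λ i →
    ≈-trans (onePlus-conj (a ℕ.+ m ℕ.* i)) (≡⇒≈ (cong (onePlus -1ℤ)
      (solve 3 (λ a m i → a :+ m :* i :+ (a :+ m :* i) := a :+ a :+ (m :+ m) :* i) ≡.refl a m i))))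
  where open +-*-Solver

sumTo≡∑ : ∀ n g → sumTo n g ≡ ∑ (downFrom (suc n)) g
sumTo≡∑ zero    g = ≡.sym (ℤₚ.+-identityʳ (g 0))
sumTo≡∑ (suc n) g = ≡.trans (ℤₚ.+-comm (sumTo n g) (g (suc n))) (cong (_+_ (g (suc n))) (sumTo≡∑ n g))

sumTo-+ : ∀ n g h → sumTo n (λ i → g i + h i) ≡ sumTo n g + sumTo n h
sumTo-+ zero    g h = ≡.refl
sumTo-+ (suc n) g h = ≡.trans (cong (_+ (g (suc n) + h (suc n))) (sumTo-+ n g h))
  (exchange (sumTo n g) (sumTo n h) (g (suc n)) (h (suc n)))
  where
  exchange : ∀ a b c d → a + b + (c + d) ≡ a + c + (b + d)
  exchange = solve-∀

-- Pairs n with -n. `interval (suc N)` consists of 0 and ±1, ..., ±(N + 1), which matches the range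
-- of the truncated sum in `lhsSeries` exactly.
Θ-squares : ∀ a N → Θ triv a a N ≡ oneₛ N + + 2 * sumTo N (λ n → mono (a ℕ.* (suc n ℕ.* suc n)) N)
Θ-squares a N = begin
  Θ triv a a N
    ≡⟨ at (∑ₛ-++ (map +_ (downFrom (suc (suc N)))) (map -[1+_] (downFrom (suc N))) F) N ⟩
  ∑ₛ (map +_ (downFrom (suc (suc N)))) F N + ∑ₛ (map -[1+_] (downFrom (suc N))) F N
    ≡⟨ cong₂ _+_ (at (∑ₛ-map +_ (downFrom (suc (suc N))) F) N) (at (∑ₛ-map -[1+_] (downFrom (suc N)) F) N) ⟩
  ∑ (downFrom (suc (suc N))) (λ n → F (+ n) N) + ∑ (downFrom (suc N)) (λ n → F -[1+ n ] N)
    ≡⟨ cong₂ _+_ (sumTo≡∑ (suc N) (λ n → F (+ n) N)) (sumTo≡∑ N (λ n → F -[1+ n ] N)) ⟨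
  sumTo (suc N) (λ n → F (+ n) N) + sumTo N (λ n → F -[1+ n ] N)
    ≡⟨ cong (_+ sumTo N (λ n → F -[1+ n ] N)) (sumTo-first N (λ n → F (+ n) N)) ⟩
  F (+ 0) N + sumTo N (λ n → F (+ suc n) N) + sumTo N (λ n → F -[1+ n ] N)
    ≡⟨ cong₂ _+_ (cong₂ _+_ (at (F-mono (+ 0)) N) (sumTo-cong N λ n _ → at (F-mono (+ suc n)) N))
                 (sumTo-cong N λ n _ → at (F-mono -[1+ n ]) N) ⟩
  mono (a ℕ.* 0) N + S + S
    ≡⟨ cong (λ k → mono k N + S + S) (ℕₚ.*-zeroʳ a) ⟩
  oneₛ N + S + S
    ≡⟨ collect (oneₛ N) S ⟩
  oneₛ N + + 2 * S ∎
  where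
  open ≡.≡-Reasoning
  F : ℤ → FPS
  F = term triv (expo a a)
  S : ℤ
  S = sumTo N (λ n → mono (a ℕ.* (suc n ℕ.* suc n)) N)
  collect : ∀ x y → x + y + y ≡ x + + 2 * y
  collect = solve-∀
  poly : ∀ a k → (a + a) * (k * k) + (a - a) * k ≡ + 2 * (a * (k * k))
  poly = solve-∀
  F-mono : ∀ k → F k ≈ mono (a ℕ.* (∣ k ∣ ℕ.* ∣ k ∣))
  F-mono k = ≈-trans (mk≈ λ n → ℤₚ.*-identityˡ (mono (expo a a k) n)) (≡⇒≈ (cong mono
    (double-injective (≡.trans (double-expo a a k) (≡.trans (poly (+ a) k) (cong (+ 2 *_)
      (≡.trans (cong (+ a *_) (square k)) (≡.sym (ℤₚ.pos-* a (∣ k ∣ ℕ.* ∣ k ∣))))))))))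
    where
    square : ∀ k → k * k ≡ + (∣ k ∣ ℕ.* ∣ k ∣)
    square (+ n)    = ≡.sym (ℤₚ.pos-* n n)
    square -[1+ n ] = ≡.refl

double-lhs : + 2 · lhsSeries ≈ Θ triv 1 1 +ₛ Θ triv 5 5
double-lhs = mk≈ λ N →
  let S₁ = sumTo N (λ n → mono (suc n ℕ.* suc n) N)
      S₅ = sumTo N (λ n → mono (5 ℕ.* (suc n ℕ.* suc n)) N) in begin
  + 2 * (oneₛ N + sumTo N (λ n → mono (suc n ℕ.* suc n) N + mono (5 ℕ.* (suc n ℕ.* suc n)) N))
    ≡⟨ cong (λ x → + 2 * (oneₛ N + x)) (sumTo-+ N _ _) ⟩
  + 2 * (oneₛ N + (S₁ + S₅))
    ≡⟨ distribute (oneₛ N) S₁ S₅ ⟩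
  oneₛ N + + 2 * S₁ + (oneₛ N + + 2 * S₅)
    ≡⟨ cong (λ x → oneₛ N + + 2 * x + (oneₛ N + + 2 * S₅))
         (sumTo-cong N λ n _ → cong (λ k → mono k N) (≡.sym (ℕₚ.*-identityˡ (suc n ℕ.* suc n)))) ⟩
  oneₛ N + + 2 * sumTo N (λ n → mono (1 ℕ.* (suc n ℕ.* suc n)) N) + (oneₛ N + + 2 * S₅)
    ≡⟨ cong₂ _+_ (Θ-squares 1 N) (Θ-squares 5 N) ⟨
  Θ triv 1 1 N + Θ triv 5 5 N ∎
  where
  open ≡.≡-Reasoning
  distribute : ∀ x y z → + 2 * (x + (y + z)) ≡ x + + 2 * y + (x + + 2 * z)
  distribute = solve-∀

·≈ : ∀ c f → c · f ≈ (c · oneₛ) *ₛ f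
·≈ c f = ≈-sym (≈-trans (·-*ₛ c oneₛ f) (·-cong {c} ≡.refl (*ₛ-identityˡ f)))

-- Relations between the theta series

private
  f₁ f₂ x₀ x₁ x₂ φ ψ f₂₈ f₄₆ q : FPS
  f₁  = Θ alt 1 4
  f₂  = Θ alt 2 3
  x₀  = Θ triv 5 5
  x₁  = Θ triv 7 3
  x₂  = Θ triv 9 1
  φ   = Θ triv 1 1
  ψ   = Θ triv 10 0
  f₂₈ = Θ triv 2 8
  f₄₆ = Θ triv 4 6
  q   = mono 1

  -1·≈ : ∀ f → -1ℤ · f ≈ negₛ f
  -1·≈ f = mk≈ λ n → ℤₚ.-1*i≡-i (f n)

  -- The choice D = 0 makes the two factors of `Θ-product` coincide and produces `ψ` as the
  -- degenerate series f(q¹⁰, 1).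
  f₁f₁ : f₁ *ₛ f₁ ≈ f₂₈ *ₛ x₀ +ₛ negₛ q *ₛ (x₁ *ₛ ψ)
  f₁f₁ = ≈-trans (Θ-product alt-character 1 3 0 1≤1+)
    (+ₛ-congˡ (f₂₈ *ₛ x₀) (*ₛ-congʳ (x₁ *ₛ ψ) (-1·≈ q)))

  f₂f₂ : f₂ *ₛ f₂ ≈ f₄₆ *ₛ x₀ +ₛ negₛ (q *ₛ q) *ₛ (x₂ *ₛ ψ)
  f₂f₂ = ≈-trans (Θ-product alt-character 2 1 0 1≤1+)
    (+ₛ-congˡ (f₄₆ *ₛ x₀) (*ₛ-congʳ (x₂ *ₛ ψ)
      (≈-trans (-1·≈ (mono 2)) (negₛ-cong (≈-sym (mono-*ₛ-mono 1 1))))))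

  f₁f₂ : f₁ *ₛ f₂ ≈ x₁ *ₛ f₄₆ +ₛ negₛ q *ₛ (f₂₈ *ₛ x₂)
  f₁f₂ = ≈-trans (Θ-product alt-character 1 2 1 1≤1+)
    (+ₛ-cong (*ₛ-congʳ f₄₆ (Θ-sym triv-character 3 7 1≤1+ 1≤1+))
      (*ₛ-cong (-1·≈ q) (*ₛ-congʳ x₂ (Θ-sym triv-character 8 2 1≤1+ 1≤1+))))

  three-term : x₀ *ₛ (f₁ *ₛ f₂) +ₛ q *ₛ (x₂ *ₛ (f₁ *ₛ f₁)) ≈ x₁ *ₛ (f₂ *ₛ f₂)
  three-term = begin
    x₀ *ₛ (f₁ *ₛ f₂) +ₛ q *ₛ (x₂ *ₛ (f₁ *ₛ f₁))
      ≈⟨ +ₛ-cong (*ₛ-congˡ x₀ f₁f₂) (*ₛ-congˡ q (*ₛ-congˡ x₂ f₁f₁)) ⟩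
    x₀ *ₛ (x₁ *ₛ f₄₆ +ₛ negₛ q *ₛ (f₂₈ *ₛ x₂)) +ₛ q *ₛ (x₂ *ₛ (f₂₈ *ₛ x₀ +ₛ negₛ q *ₛ (x₁ *ₛ ψ)))
      -- The two terms in q x₀ x₂ f₂₈ cancel, and `x₁` is common to what remains.
      ≈⟨ solve 7 (λ x₀ x₁ x₂ f₂₈ f₄₆ ψ q →
           x₀ :* (x₁ :* f₄₆ :+ :- q :* (f₂₈ :* x₂)) :+ q :* (x₂ :* (f₂₈ :* x₀ :+ :- q :* (x₁ :* ψ))) :=
           x₁ :* (f₄₆ :* x₀ :+ :- (q :* q) :* (x₂ :* ψ))) ≈-refl x₀ x₁ x₂ f₂₈ f₄₆ ψ q ⟩
    x₁ *ₛ (f₄₆ *ₛ x₀ +ₛ negₛ (q *ₛ q) *ₛ (x₂ *ₛ ψ))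
      ≈⟨ *ₛ-congˡ x₁ f₂f₂ ⟨
    x₁ *ₛ (f₂ *ₛ f₂) ∎
    where
    open Solver
    open import Relation.Binary.Reasoning.Setoid setoid

  U V g : FPS
  g = f₁ *ₛ f₂
  U = x₀ *ₛ g
  V = q *ₛ (x₂ *ₛ (f₁ *ₛ f₁))

  -- Since U + V = x₁ f₂² by `three-term`, multiplying φ² = x₀² + 4 q x₁ x₂ by g² gives U² + 4 V (U
  -- + V), a perfect square.
  φg² : (φ *ₛ g) *ₛ (φ *ₛ g) ≈ (U +ₛ V +ₛ V) *ₛ (U +ₛ V +ₛ V)
  φg² = begin
    (φ *ₛ g) *ₛ (φ *ₛ g)
      ≈⟨ solve 2 (λ φ g → (φ :* g) :* (φ :* g) := (φ :* φ) :* (g :* g)) ≈-refl φ g ⟩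
    (φ *ₛ φ) *ₛ (g *ₛ g)
      ≈⟨ *ₛ-congʳ (g *ₛ g) (≈-trans φ-squares (+ₛ-congˡ (x₀ *ₛ x₀) (·≈ (+ 4) (q *ₛ (x₂ *ₛ x₁))))) ⟩
    (x₀ *ₛ x₀ +ₛ (+ 4 · oneₛ) *ₛ (q *ₛ (x₂ *ₛ x₁))) *ₛ (g *ₛ g)
      ≈⟨ solve 6 (λ x₀ q x₂ x₁ f₁ f₂ →
           (x₀ :* x₀ :+ con (+ 4) :* (q :* (x₂ :* x₁))) :* ((f₁ :* f₂) :* (f₁ :* f₂)) :=
           (x₀ :* (f₁ :* f₂)) :* (x₀ :* (f₁ :* f₂)) :+ con (+ 4) :* (q :* (x₂ :* (f₁ :* f₁))) :* (x₁ :* (f₂ :* f₂)))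
           ≈-refl x₀ q x₂ x₁ f₁ f₂ ⟩
    U *ₛ U +ₛ (+ 4 · oneₛ) *ₛ V *ₛ (x₁ *ₛ (f₂ *ₛ f₂))
      ≈⟨ +ₛ-congˡ (U *ₛ U) (*ₛ-congˡ ((+ 4 · oneₛ) *ₛ V) three-term) ⟨
    U *ₛ U +ₛ (+ 4 · oneₛ) *ₛ V *ₛ (U +ₛ V)
      ≈⟨ solve 2 (λ u v → u :* u :+ con (+ 4) :* v :* (u :+ v) := (u :+ v :+ v) :* (u :+ v :+ v)) ≈-refl U V ⟩
    (U +ₛ V +ₛ V) *ₛ (U +ₛ V +ₛ V) ∎
    where
    open Solver
    open import Relation.Binary.Reasoning.Setoid setoid

  φg : φ *ₛ g ≈ U +ₛ V +ₛ V
  -- The constant term of `φ *ₛ g +ₛ W` computes to 2, so this factor of the difference of squares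
  -- can be cancelled.
  φg = negₛ-zero⇒≈ (*ₛ-zero-cancel (φ *ₛ g +ₛ W) (φ *ₛ g +ₛ negₛ W) (λ ())
    (≈-trans (solve 2 (λ x y → (x :+ y) :* (x :+ :- y) := x :* x :+ :- (y :* y)) ≈-refl (φ *ₛ g) W)
             (≈⇒negₛ-zero φg²)))
    where
    open Solver
    W : FPS
    W = U +ₛ V +ₛ V

-- Adding U to φ g = U + 2 V gives 2 (U + V) = 2 x₁ f₂², so that `f₂` becomes a common factor of
-- both sides; its constant term is nonzero.
φ-sum : (Θ triv 1 1 +ₛ Θ triv 5 5) *ₛ Θ alt 1 4 ≈ + 2 · (Θ triv 7 3 *ₛ Θ alt 2 3)
φ-sum = ≈-trans (*ₛ-cancelˡ f₂ (λ ()) (begin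
  f₂ *ₛ ((φ +ₛ x₀) *ₛ f₁)
    ≈⟨ solve 4 (λ φ x₀ f₁ f₂ → f₂ :* ((φ :+ x₀) :* f₁) := φ :* (f₁ :* f₂) :+ x₀ :* (f₁ :* f₂)) ≈-refl φ x₀ f₁ f₂ ⟩
  φ *ₛ g +ₛ U
    ≈⟨ +ₛ-congʳ U φg ⟩
  U +ₛ V +ₛ V +ₛ U
    ≈⟨ solve 2 (λ u v → u :+ v :+ v :+ u := con (+ 2) :* (u :+ v)) ≈-refl U V ⟩
  (+ 2 · oneₛ) *ₛ (U +ₛ V)
    ≈⟨ *ₛ-congˡ (+ 2 · oneₛ) three-term ⟩
  (+ 2 · oneₛ) *ₛ (x₁ *ₛ (f₂ *ₛ f₂))
    ≈⟨ solve 2 (λ x₁ f₂ → con (+ 2) :* (x₁ :* (f₂ :* f₂)) := f₂ :* (con (+ 2) :* (x₁ :* f₂))) ≈-refl x₁ f₂ ⟩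
  f₂ *ₛ ((+ 2 · oneₛ) *ₛ (x₁ *ₛ f₂)) ∎))
  (≈-sym (·≈ (+ 2) (x₁ *ₛ f₂)))
  where
  open Solver
  open import Relation.Binary.Reasoning.Setoid setoid

lhs-f₁ : lhsSeries *ₛ Θ alt 1 4 ≈ Θ triv 7 3 *ₛ Θ alt 2 3
lhs-f₁ = mk≈ λ n → ℤₚ.*-cancelˡ-≡ (+ 2) _ _ (at (≈-trans (≈-sym (·-*ₛ (+ 2) lhsSeries f₁))
  (≈-trans (*ₛ-congʳ f₁ double-lhs) φ-sum)) n)

-- From theta series to infinite products

private
  P : ℕ → ℕ → FPS
  P = poch⁺ -1ℤ

-- The factor (q⁵ ; q⁵)_∞ completes the denominator to the triple product of `f₁`; the triple
-- product of `f₂` supplies the same factor on the other side.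
lhs-denominator : lhsSeries *ₛ denominator ≈ numerator
lhs-denominator = *ₛ-cancelˡ (P 5 5) (λ ()) (begin
  P 5 5 *ₛ (lhsSeries *ₛ denominator)
    ≈⟨ *ₛ-congˡ (P 5 5) (*ₛ-congˡ lhsSeries (*ₛ-cong (poch≈poch⁺ 1 5) (poch≈poch⁺ 4 5))) ⟩
  P 5 5 *ₛ (lhsSeries *ₛ (P 1 5 *ₛ P 4 5))
    ≈⟨ solve 4 (λ p l a b → p :* (l :* (a :* b)) := l :* (a :* (b :* p))) ≈-refl (P 5 5) lhsSeries (P 1 5) (P 4 5) ⟩
  lhsSeries *ₛ (P 1 5 *ₛ (P 4 5 *ₛ P 5 5))
    ≈⟨ *ₛ-congˡ lhsSeries (jacobi alt-character 1 4 1≤1+ 1≤1+) ⟨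
  lhsSeries *ₛ f₁
    ≈⟨ lhs-f₁ ⟩
  x₁ *ₛ f₂
    ≈⟨ *ₛ-cong (jacobi triv-character 7 3 1≤1+ 1≤1+) (jacobi alt-character 2 3 1≤1+ 1≤1+) ⟩
  poch⁺ 1ℤ 7 10 *ₛ (poch⁺ 1ℤ 3 10 *ₛ P 10 10) *ₛ (P 2 5 *ₛ (P 3 5 *ₛ P 5 5))
    -- In base q¹⁰ the factors (q³ ; q¹⁰)_∞ and (q⁷ ; q¹⁰)_∞ of `f₂` meet (-q³ ; q¹⁰)_∞ and (-q⁷ ;
    -- q¹⁰)_∞ from `x₁`; the pairs multiply to the products of base q²⁰.
    ≈⟨ *ₛ-congˡ (poch⁺ 1ℤ 7 10 *ₛ (poch⁺ 1ℤ 3 10 *ₛ P 10 10))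
         (*ₛ-cong (poch⁺-split -1ℤ 2 5 1≤1+ 1≤1+) (*ₛ-congʳ (P 5 5) (poch⁺-split -1ℤ 3 5 1≤1+ 1≤1+))) ⟩
  poch⁺ 1ℤ 7 10 *ₛ (poch⁺ 1ℤ 3 10 *ₛ P 10 10) *ₛ (P 2 10 *ₛ P 7 10 *ₛ (P 3 10 *ₛ P 8 10 *ₛ P 5 5))
    ≈⟨ solve 8 (λ a b c d e f g p → a :* (b :* c) :* (d :* e :* (f :* g :* p)) :=
                                     p :* (d :* g :* c :* (b :* f) :* (a :* e))) ≈-refl
         (poch⁺ 1ℤ 7 10) (poch⁺ 1ℤ 3 10) (P 10 10) (P 2 10) (P 7 10) (P 3 10) (P 8 10) (P 5 5) ⟩
  P 5 5 *ₛ (P 2 10 *ₛ P 8 10 *ₛ P 10 10 *ₛ (poch⁺ 1ℤ 3 10 *ₛ P 3 10) *ₛ (poch⁺ 1ℤ 7 10 *ₛ P 7 10))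
    ≈⟨ *ₛ-congˡ (P 5 5) (*ₛ-cong (*ₛ-congˡ (P 2 10 *ₛ P 8 10 *ₛ P 10 10) (poch⁺-conj 3 10 1≤1+ 1≤1+)) (poch⁺-conj 7 10 1≤1+ 1≤1+)) ⟩
  P 5 5 *ₛ (P 2 10 *ₛ P 8 10 *ₛ P 10 10 *ₛ P 6 20 *ₛ P 14 20)
    ≈⟨ *ₛ-congˡ (P 5 5) (*ₛ-cong (*ₛ-cong (*ₛ-cong (*ₛ-cong (poch≈poch⁺ 2 10) (poch≈poch⁺ 8 10))
         (poch≈poch⁺ 10 10)) (poch≈poch⁺ 6 20)) (poch≈poch⁺ 14 20)) ⟨
  P 5 5 *ₛ numerator ∎)
  where
  open Solver
  open JacobiTripleProduct using (jacobi)
  open import Relation.Binary.Reasoning.Setoid setoid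

theorem15 : (N : ℕ) → lhsSeries N ≡ (numerator *ₛ invₛ denominator) N
theorem15 = at (begin
  lhsSeries
    ≈⟨ *ₛ-identityʳ lhsSeries ⟨
  lhsSeries *ₛ oneₛ
    ≈⟨ *ₛ-congˡ lhsSeries (*ₛ-inverseʳ denominator ≡.refl) ⟨
  lhsSeries *ₛ (denominator *ₛ invₛ denominator)
    ≈⟨ *ₛ-assoc lhsSeries denominator (invₛ denominator) ⟨
  (lhsSeries *ₛ denominator) *ₛ invₛ denominator
    ≈⟨ *ₛ-congʳ (invₛ denominator) lhs-denominator ⟩
  numerator *ₛ invₛ denominator ∎)
  where open import Relation.Binary.Reasoning.Setoid setoid
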